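{- Let $\mathcal{C}$ be a small cartesian closed subcategory of $\mathbf{Set}$ and let $((A,\mathrm{st}^A),m,e)$ be a monoid in $\mathsf{SPro}$. Let $A^A$ be the exponential of $A$ by itself in $\mathsf{Pro}$, so that $TA^A=T(A^A)$ has underlying profunctor $$(X,Y)\mapsto\int_Z\int_D A(Y\times Z,D)\to A(X\times Z,D).$$ Define $\mathrm{rep}_{X,Y}:A(X,Y)\to (UTA^A)(X,Y)$ by letting the $(Z,D)$-component of $\mathrm{rep}_{X,Y}(a)$ be the function $$A(Y\times Z,D)\to A(X\times Z,D),\qquad b\mapsto m\big[\mathrm{st}^A_Z(a),b\big]_{Y\times Z},$$ and define $\mathrm{abs}_{X,Y}:(UTA^A)(X,Y)\to A(X,Y)$ by $$\mathrm{abs}_{X,Y}(h)=A(\pi_1^{ -1},\mathrm{id})\big(h_{1,Y}(e(\pi_1))\big),$$ where $h_{1,Y}:A(Y\times1,Y)\to A(X\times1,Y)$ is the $(Z,D)=(1,Y)$ component of $h$, $e(\pi_1)\in A(Y\times1,Y)$ is the image of $\pi_1\in\mathrm{Hom}(Y\times1,Y)$, and $\pi_1^{ -1}:X\to X\times1$. Then $\mathrm{rep}$ is a morphism $(A,\mathrm{st}^A)\to TA^A$ in $\mathsf{SPro}$ (in particular it commutes with the strengths of $A$ and $TA^A$), $\mathrm{abs}$ is a morphism $UTA^A\to U(A,\mathrm{st}^A)$ in $\mathsf{Pro}$ satisfying $\mathrm{abs}\circ U(\mathrm{rep})=\mathrm{id}_A$, and therefore $\mathrm{rep}$ is a monomo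rphism.
   Context: A profunctor on $\mathcal{C}$ is a functor $\mathcal{C}^{\mathrm{op}}\times\mathcal{C}\to\mathbf{Set}$. $\mathsf{Pro}$ is the category $[\mathcal{C}^{\mathrm{op}}\times\mathcal{C},\mathbf{Set}]$ with tensor $(F\otimes G)(X,Y)=\int^{P}F(X,P)\times G(P,Y)$ and unit $\mathrm{Hom}$; $[x,y]_P$ denotes the class in the coend of $(x,y)\in F(X,P)\times G(P,Y)$. It is right closed (i.e. $-\otimes A$ has a right adjoint), with exponential $B^A(X,Y)=\mathrm{Nat}(A(Y,-),B(X,-))=\int_D A(Y,D)\to B(X,D)$, where $\to$ inside an end denotes the set of functions. A strength for a profunctor $F$ is a family $\mathrm{st}_{X,Y,Z}:F(X,Y)\to F(X\times Z,Y\times Z)$, natural in $X,Y$ and dinatural in $Z$, such that $F(\mathrm{id},\pi_1)\circ\mathrm{st}_1=F(\pi_1,\mathrm{id}):F(X,Y)\to F(X\times1,Y)$ and $\mathrm{st}_W\circ\mathrm{st}_V=F(\alpha,\alpha^{ -1})\circ\mathrm{st}_{V\times W}$, where $\alpha:(X\times V)\times W\to X\times(V\times W)$ is the canonical isomorphism (and likewise with $Y$). $\mathsf{SPro}$ is the category whose objects are pairs $(F,\mathrm{st})$ of a profunctor and a strength and whose morphisms are strong natural transformations, i.e. natural transformations $\theta$ with $\theta\circ\mathrm{st}^F=\mathrm{st}^G\circ\theta$; it has the monoidal structure of $\mathsf{Pro}$, where $A\otimes B$ has strength $[x,y]_P\mapsto[\mathrm{st}^A_Z(x),\mathrm{st}^B_Z(y)]_{P\times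 Z}$ and $\mathrm{Hom}$ has strength $f\mapsto f\times\mathrm{id}_Z$. A monoid in $\mathsf{SPro}$ thus has multiplication $m:A\otimes A\to A$ and unit $e:\mathrm{Hom}\to A$, both strong natural transformations, satisfying the associativity and unit laws. $U:\mathsf{SPro}\to\mathsf{Pro}$ forgets the strength. $T:\mathsf{Pro}\to\mathsf{SPro}$ sends $B$ to $(T_B,\mathrm{st})$, where $T_B(X,Y)=\int_Z B(X\times Z,Y\times Z)$ and, writing $t_Z\in B(X\times Z,Y\times Z)$ for the components of $t\in T_B(X,Y)$, the strength is $(\mathrm{st}_Z(t))_V=B(\alpha,\alpha^{ -1})(t_{Z\times V})\in B((X\times Z)\times V,(Y\times Z)\times V)$. -}

module Defs where

open import Level using (Level; _⊔_) renaming (suc to lsuc)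
open import Data.Product.Base using (Σ; _×_; _,_; proj₁; proj₂; Σ-syntax)
open import Data.Product.Relation.Binary.Pointwise.NonDependent using (×-setoid)
open import Data.Sum.Base using (inj₁; inj₂)
open import Function.Bundles using (Func; _⟨$⟩_)
import Function.Construct.Composition as Compose
import Function.Construct.Identity as Identity
import Function.Relation.Binary.Setoid.Equality as FuncEq
open import Relation.Binary.Bundles using (Setoid)
open import Relation.Binary.Structures using (IsEquivalence)
import Relation.Binary.Construct.Closure.Equivalence as EqC
open import Relation.Binary.Construct.Closure.ReflexiveTransitive using (ε; _◅_; _◅◅_)
open import Relation.Binary.Construct.Closure.Symmetric using (fwd; bwd)
import Relation.Binary.Construct.On as On
import Relation.Binary.Reasoning.Setoid as SetoidReasoning

-- Records below that are declared without eta have an INLINE constructor, so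
-- that their values are defined by copatterns and are not unfolded when compared;
-- this affects type-checking time only.
record Category (o ℓ : Level) : Set (lsuc (o ⊔ ℓ)) where
  no-eta-equality
  infix  4 _≈_ _⇒_
  infixr 9 _∘_
  field
    Obj       : Set o
    _⇒_       : Obj → Obj → Set ℓ
    _≈_       : ∀ {A B} → A ⇒ B → A ⇒ B → Set ℓ
    id        : ∀ {A} → A ⇒ A
    _∘_       : ∀ {A B C} → B ⇒ C → A ⇒ B → A ⇒ C
    assoc     : ∀ {A B C D} {f : A ⇒ B} {g : B ⇒ C} {h : C ⇒ D} →
                (h ∘ g) ∘ f ≈ h ∘ (g ∘ f)
    identityˡ : ∀ {A B} {f : A ⇒ B} → id ∘ f ≈ f
    identityʳ : ∀ {A B} {f : A ⇒ B} → f ∘ id ≈ f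
    equiv     : ∀ {A B} → IsEquivalence (_≈_ {A} {B})
    ∘-resp-≈  : ∀ {A B C} {f f′ : B ⇒ C} {g g′ : A ⇒ B} →
                f ≈ f′ → g ≈ g′ → f ∘ g ≈ f′ ∘ g′

  module Equiv {A B : Obj} = IsEquivalence (equiv {A} {B})

  hom-setoid : Obj → Obj → Setoid ℓ ℓ
  hom-setoid A B = record { isEquivalence = equiv {A} {B} }

{-# INLINE Category.constructor #-}

infix 10 _[_,_] _[_≈_]

_[_,_] : ∀ {o ℓ} (C : Category o ℓ) → Category.Obj C → Category.Obj C → Set ℓ
C [ X , Y ] = Category._⇒_ C X Y

_[_≈_] : ∀ {o ℓ} (C : Category o ℓ) {X Y : Category.Obj C} →
         C [ X , Y ] → C [ X , Y ] → Set ℓ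
C [ f ≈ g ] = Category._≈_ C f g

Mono : ∀ {o ℓ} (C : Category o ℓ) {X Y : Category.Obj C} → C [ X , Y ] → Set (o ⊔ ℓ)
Mono C {X} f = ∀ {W} (g h : C [ W , X ]) → f ∘ g ≈ f ∘ h → g ≈ h
  where open Category C

op : ∀ {o ℓ} → Category o ℓ → Category o ℓ
op C = record
  { Obj       = Obj
  ; _⇒_       = λ A B → B ⇒ A
  ; _≈_       = _≈_
  ; id        = id
  ; _∘_       = λ f g → g ∘ f
  ; assoc     = Equiv.sym assoc
  ; identityˡ = identityʳ
  ; identityʳ = identityˡ
  ; equiv     = equiv
  ; ∘-resp-≈  = λ p q → ∘-resp-≈ q p
  } where open Category C

Product : ∀ {o ℓ o′ ℓ′} → Category o ℓ → Category o′ ℓ′ → Category (o ⊔ o′) (ℓ ⊔ ℓ′)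
Product C D = record
  { Obj       = C.Obj × D.Obj
  ; _⇒_       = λ A B → (proj₁ A C.⇒ proj₁ B) × (proj₂ A D.⇒ proj₂ B)
  ; _≈_       = λ f g → (proj₁ f C.≈ proj₁ g) × (proj₂ f D.≈ proj₂ g)
  ; id        = C.id , D.id
  ; _∘_       = λ f g → (proj₁ f C.∘ proj₁ g) , (proj₂ f D.∘ proj₂ g)
  ; assoc     = C.assoc , D.assoc
  ; identityˡ = C.identityˡ , D.identityˡ
  ; identityʳ = C.identityʳ , D.identityʳ
  ; equiv     = record
    { refl  = C.Equiv.refl , D.Equiv.refl
    ; sym   = λ p → C.Equiv.sym (proj₁ p) , D.Equiv.sym (proj₂ p)
    ; trans = λ p q → C.Equiv.trans (proj₁ p) (proj₁ q) , D.Equiv.trans (proj₂ p) (proj₂ q)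
    }
  ; ∘-resp-≈  = λ p q → C.∘-resp-≈ (proj₁ p) (proj₁ q) , D.∘-resp-≈ (proj₂ p) (proj₂ q)
  } where module C = Category C
          module D = Category D

-- The category Set.  Quotients (hence coends) and extensional equality of
-- functions do not exist on bare Agda types, so a set is a setoid here and a
-- function is an equality-preserving one.
Setoids : ∀ ℓ → Category (lsuc ℓ) ℓ
Setoids ℓ = record
  { Obj       = Setoid ℓ ℓ
  ; _⇒_       = Func
  ; _≈_       = λ {A} {B} → FuncEq._≈_ A B
  ; id        = λ {A} → Identity.function A
  ; _∘_       = λ g f → Compose.function f g
  ; assoc     = λ {_} {_} {_} {D} _ → Setoid.refl D
  ; identityˡ = λ {_} {B} _ → Setoid.refl B
  ; identityʳ = λ {_} {B} _ → Setoid.refl B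
  ; equiv     = λ {A} {B} → FuncEq.isEquivalence A B
  ; ∘-resp-≈  = λ {_} {_} {C} {f} {f′} {g} {g′} p q x →
                  Setoid.trans C (Func.cong f (q x)) (p (g′ ⟨$⟩ x))
  }

-- Not necessarily full: the objects are named by the elements of I, and the
-- morphisms are those ambient ones satisfying isMor.
record Subcategory {o ℓ} (D : Category o ℓ) (i : Level) : Set (o ⊔ lsuc (i ⊔ ℓ)) where
  private module D = Category D
  field
    I            : Set i
    El           : I → D.Obj
    isMor        : ∀ {a b} → El a D.⇒ El b → Set ℓ
    isMor-resp-≈ : ∀ {a b} {f g : El a D.⇒ El b} → f D.≈ g → isMor {a} {b} f → isMor {a} {b} g
    isMor-id     : ∀ {a} → isMor {a} {a} D.id
    isMor-∘      : ∀ {a b c} {g : El b D.⇒ El c} {f : El a D.⇒ El b} →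
                   isMor {b} {c} g → isMor {a} {b} f → isMor {a} {c} (g D.∘ f)

  category : Category i ℓ
  category = record
    { Obj       = I
    ; _⇒_       = λ a b → Σ (El a D.⇒ El b) (isMor {a} {b})
    ; _≈_       = λ f g → proj₁ f D.≈ proj₁ g
    ; id        = D.id , isMor-id
    ; _∘_       = λ g f → (proj₁ g D.∘ proj₁ f) , isMor-∘ (proj₂ g) (proj₂ f)
    ; assoc     = D.assoc
    ; identityˡ = D.identityˡ
    ; identityʳ = D.identityʳ
    ; equiv     = On.isEquivalence proj₁ D.equiv
    ; ∘-resp-≈  = D.∘-resp-≈
    }

-- Cartesian closure is a structure on the category itself; for a subcategory of
-- Set it need not be computed as in Set.
record CartesianClosed {o ℓ} (C : Category o ℓ) : Set (o ⊔ ℓ) where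
  open Category C
  infixr 7 _⊠_
  infixr 8 _⊠₁_
  field
    𝟙         : Obj
    !         : ∀ {X} → X ⇒ 𝟙
    !-unique  : ∀ {X} (f : X ⇒ 𝟙) → ! ≈ f

    _⊠_       : Obj → Obj → Obj
    π₁        : ∀ {X Y} → X ⊠ Y ⇒ X
    π₂        : ∀ {X Y} → X ⊠ Y ⇒ Y
    ⟨_,_⟩     : ∀ {W X Y} → W ⇒ X → W ⇒ Y → W ⇒ X ⊠ Y
    project₁  : ∀ {W X Y} {f : W ⇒ X} {g : W ⇒ Y} → π₁ ∘ ⟨ f , g ⟩ ≈ f
    project₂  : ∀ {W X Y} {f : W ⇒ X} {g : W ⇒ Y} → π₂ ∘ ⟨ f , g ⟩ ≈ g
    ⟨⟩-unique : ∀ {W X Y} {f : W ⇒ X} {g : W ⇒ Y} {h : W ⇒ X ⊠ Y} →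
                π₁ ∘ h ≈ f → π₂ ∘ h ≈ g → ⟨ f , g ⟩ ≈ h

  _⊠₁_ : ∀ {X X′ Y Y′} → X ⇒ X′ → Y ⇒ Y′ → X ⊠ Y ⇒ X′ ⊠ Y′
  f ⊠₁ g = ⟨ f ∘ π₁ , g ∘ π₂ ⟩

  field
    _⇨_       : Obj → Obj → Obj
    eval      : ∀ {X Y} → (X ⇨ Y) ⊠ X ⇒ Y
    curry     : ∀ {W X Y} → W ⊠ X ⇒ Y → W ⇒ (X ⇨ Y)
    β         : ∀ {W X Y} {f : W ⊠ X ⇒ Y} → eval ∘ (curry f ⊠₁ id) ≈ f
    λ-unique  : ∀ {W X Y} {f : W ⊠ X ⇒ Y} {h : W ⇒ (X ⇨ Y)} →
                eval ∘ (h ⊠₁ id) ≈ f → curry f ≈ h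

  π₁⁻¹ : ∀ {X} → X ⇒ X ⊠ 𝟙
  π₁⁻¹ = ⟨ id , ! ⟩

  α : ∀ {X V W} → (X ⊠ V) ⊠ W ⇒ X ⊠ (V ⊠ W)
  α = ⟨ π₁ ∘ π₁ , ⟨ π₂ ∘ π₁ , π₂ ⟩ ⟩

  α⁻¹ : ∀ {X V W} → X ⊠ (V ⊠ W) ⇒ (X ⊠ V) ⊠ W
  α⁻¹ = ⟨ ⟨ π₁ , π₁ ∘ π₂ ⟩ , π₂ ∘ π₂ ⟩

  private
    open Equiv
    infixr 4 _▸_
    _▸_ : ∀ {A B} {f g h : A ⇒ B} → f ≈ g → g ≈ h → f ≈ h
    _▸_ = trans

  ⟨⟩-ext : ∀ {W X Y} {h k : W ⇒ X ⊠ Y} → π₁ ∘ h ≈ π₁ ∘ k → π₂ ∘ h ≈ π₂ ∘ k → h ≈ k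
  ⟨⟩-ext p q = sym (⟨⟩-unique p q) ▸ ⟨⟩-unique refl refl

  ⟨⟩-cong : ∀ {W X Y} {f f′ : W ⇒ X} {g g′ : W ⇒ Y} → f ≈ f′ → g ≈ g′ → ⟨ f , g ⟩ ≈ ⟨ f′ , g′ ⟩
  ⟨⟩-cong p q = ⟨⟩-unique (project₁ ▸ sym p) (project₂ ▸ sym q)

  ⟨⟩∘ : ∀ {V W X Y} {f : W ⇒ X} {g : W ⇒ Y} {h : V ⇒ W} →
        ⟨ f , g ⟩ ∘ h ≈ ⟨ f ∘ h , g ∘ h ⟩
  ⟨⟩∘ = sym (⟨⟩-unique (sym assoc ▸ ∘-resp-≈ project₁ refl)
                       (sym assoc ▸ ∘-resp-≈ project₂ refl))

  ⊠₁-cong : ∀ {X X′ Y Y′} {f f′ : X ⇒ X′} {g g′ : Y ⇒ Y′} →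
            f ≈ f′ → g ≈ g′ → f ⊠₁ g ≈ f′ ⊠₁ g′
  ⊠₁-cong p q = ⟨⟩-cong (∘-resp-≈ p refl) (∘-resp-≈ q refl)

  ⊠₁-id : ∀ {X Y} → id {X} ⊠₁ id {Y} ≈ id
  ⊠₁-id = ⟨⟩-unique (identityʳ ▸ sym identityˡ) (identityʳ ▸ sym identityˡ)

  ⊠₁∘⟨⟩ : ∀ {W X X′ Y Y′} {f : X ⇒ X′} {g : Y ⇒ Y′} {h : W ⇒ X} {k : W ⇒ Y} →
          (f ⊠₁ g) ∘ ⟨ h , k ⟩ ≈ ⟨ f ∘ h , g ∘ k ⟩
  ⊠₁∘⟨⟩ = ⟨⟩∘ ▸ ⟨⟩-cong (assoc ▸ ∘-resp-≈ refl project₁) (assoc ▸ ∘-resp-≈ refl project₂)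

  ⊠₁-∘ : ∀ {X X′ X″ Y Y′ Y″} {f : X′ ⇒ X″} {g : Y′ ⇒ Y″} {h : X ⇒ X′} {k : Y ⇒ Y′} →
         (f ∘ h) ⊠₁ (g ∘ k) ≈ (f ⊠₁ g) ∘ (h ⊠₁ k)
  ⊠₁-∘ = ⟨⟩-cong assoc assoc ▸ sym ⊠₁∘⟨⟩

  α-natural : ∀ {X X′ V V′ W W′} {f : X ⇒ X′} {g : V ⇒ V′} {h : W ⇒ W′} →
              α ∘ ((f ⊠₁ g) ⊠₁ h) ≈ (f ⊠₁ (g ⊠₁ h)) ∘ α
  α-natural =
      ⟨⟩∘
    ▸ ⟨⟩-cong
        (assoc ▸ ∘-resp-≈ refl project₁ ▸ sym assoc ▸ ∘-resp-≈ project₁ refl ▸ assoc)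
        ( ⟨⟩∘
        ▸ ⟨⟩-cong
            (assoc ▸ ∘-resp-≈ refl project₁ ▸ sym assoc ▸ ∘-resp-≈ project₂ refl ▸ assoc)
            project₂
        ▸ sym ⊠₁∘⟨⟩)
    ▸ sym ⊠₁∘⟨⟩

  α∘α⁻¹ : ∀ {X V W} → α {X} {V} {W} ∘ α⁻¹ ≈ id
  α∘α⁻¹ =
      ⟨⟩∘
    ▸ ⟨⟩-unique
        (identityʳ ▸ sym (assoc ▸ ∘-resp-≈ refl project₁ ▸ project₁))
        (identityʳ ▸ sym
          ( ⟨⟩∘
          ▸ ⟨⟩-unique
              (sym (assoc ▸ ∘-resp-≈ refl project₁ ▸ project₂))
              (sym project₂)))

  α⁻¹∘α : ∀ {X V W} → α⁻¹ {X} {V} {W} ∘ α ≈ id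
  α⁻¹∘α =
      ⟨⟩∘
    ▸ ⟨⟩-unique
        (identityʳ ▸ sym
          ( ⟨⟩∘
          ▸ ⟨⟩-unique
              (sym project₁)
              (sym (assoc ▸ ∘-resp-≈ refl project₂ ▸ project₁))))
        (identityʳ ▸ sym (assoc ▸ ∘-resp-≈ refl project₂ ▸ project₂))

  α⁻¹-natural : ∀ {X X′ V V′ W W′} {f : X ⇒ X′} {g : V ⇒ V′} {h : W ⇒ W′} →
                α⁻¹ ∘ (f ⊠₁ (g ⊠₁ h)) ≈ ((f ⊠₁ g) ⊠₁ h) ∘ α⁻¹
  α⁻¹-natural =
      ∘-resp-≈ refl (sym identityʳ ▸ ∘-resp-≈ refl (sym α∘α⁻¹) ▸ sym assoc
                     ▸ ∘-resp-≈ (sym α-natural) refl ▸ assoc)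
    ▸ sym assoc ▸ ∘-resp-≈ α⁻¹∘α refl ▸ identityˡ

record Functor {o ℓ o′ ℓ′} (C : Category o ℓ) (D : Category o′ ℓ′) :
               Set (o ⊔ ℓ ⊔ o′ ⊔ ℓ′) where
  no-eta-equality
  private module C = Category C
          module D = Category D
  field
    F₀           : C.Obj → D.Obj
    F₁           : ∀ {A B} → A C.⇒ B → F₀ A D.⇒ F₀ B
    identity     : ∀ {A} → F₁ (C.id {A}) D.≈ D.id
    homomorphism : ∀ {X Y Z} {f : X C.⇒ Y} {g : Y C.⇒ Z} → F₁ (g C.∘ f) D.≈ F₁ g D.∘ F₁ f
    F-resp-≈     : ∀ {A B} {f g : A C.⇒ B} → f C.≈ g → F₁ f D.≈ F₁ g

{-# INLINE Functor.constructor #-}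

record NatTrans {o ℓ o′ ℓ′} {C : Category o ℓ} {D : Category o′ ℓ′} (F G : Functor C D) :
                Set (o ⊔ ℓ ⊔ ℓ′) where
  no-eta-equality
  private module C = Category C
          module D = Category D
          module F = Functor F
          module G = Functor G
  field
    η       : ∀ X → F.F₀ X D.⇒ G.F₀ X
    commute : ∀ {X Y} (f : X C.⇒ Y) → η Y D.∘ F.F₁ f D.≈ G.F₁ f D.∘ η X

{-# INLINE NatTrans.constructor #-}

FunctorCat : ∀ {o ℓ} → Category ℓ ℓ → Category o ℓ → Category (o ⊔ ℓ) ℓ
FunctorCat C D = record
  { Obj       = Functor C D
  ; _⇒_       = NatTrans
  ; _≈_       = λ θ φ → ∀ X → η θ X ≈ η φ X
  ; id        = record
    { η       = λ _ → id
    ; commute = λ _ → Equiv.trans identityˡ (Equiv.sym identityʳ) }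
  ; _∘_       = λ θ φ → record
    { η       = λ X → η θ X ∘ η φ X
    ; commute = λ f → Equiv.trans assoc
                     (Equiv.trans (∘-resp-≈ Equiv.refl (commute φ f))
                     (Equiv.trans (Equiv.sym assoc)
                     (Equiv.trans (∘-resp-≈ (commute θ f) Equiv.refl) assoc))) }
  ; assoc     = λ _ → assoc
  ; identityˡ = λ _ → identityˡ
  ; identityʳ = λ _ → identityʳ
  ; equiv     = record
    { refl  = λ _ → Equiv.refl
    ; sym   = λ p X → Equiv.sym (p X)
    ; trans = λ p q X → Equiv.trans (p X) (q X) }
  ; ∘-resp-≈  = λ p q X → ∘-resp-≈ (p X) (q X)
  }
  where
    open Category D
    open NatTrans

module Profunctors {ℓ} (C : Category ℓ ℓ) where
  open Category C

  Pro : Category (lsuc ℓ) ℓ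
  Pro = FunctorCat (Product (op C) C) (Setoids ℓ)

  Profunctor : Set (lsuc ℓ)
  Profunctor = Category.Obj Pro

  private
    variable
      X X′ X″ Y Y′ Y″ : Obj

  infix 10 _⟦_,_⟧
  _⟦_,_⟧ : Profunctor → Obj → Obj → Setoid ℓ ℓ
  F ⟦ X , Y ⟧ = Functor.F₀ F (X , Y)

  ∣_∣ : Setoid ℓ ℓ → Set ℓ
  ∣ S ∣ = Setoid.Carrier S

  module _ (F : Profunctor) where
    open Functor F

    dimap : X′ ⇒ X → Y ⇒ Y′ → ∣ F ⟦ X , Y ⟧ ∣ → ∣ F ⟦ X′ , Y′ ⟧ ∣
    dimap f g x = F₁ (f , g) ⟨$⟩ x

    private
      infix 4 _∼_
      _∼_ : ∣ F ⟦ X , Y ⟧ ∣ → ∣ F ⟦ X , Y ⟧ ∣ → Set ℓ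
      _∼_ {X} {Y} = Setoid._≈_ (F ⟦ X , Y ⟧)

    dimap-cong : {f : X′ ⇒ X} {g : Y ⇒ Y′} {x x′ : ∣ F ⟦ X , Y ⟧ ∣} →
                 x ∼ x′ → dimap f g x ∼ dimap f g x′
    dimap-cong = Func.cong (F₁ _)

    dimap-resp : {f f′ : X′ ⇒ X} {g g′ : Y ⇒ Y′} → f ≈ f′ → g ≈ g′ →
                 (x : ∣ F ⟦ X , Y ⟧ ∣) → dimap f g x ∼ dimap f′ g′ x
    dimap-resp p q = F-resp-≈ (p , q)

    dimap-id : (x : ∣ F ⟦ X , Y ⟧ ∣) → dimap id id x ∼ x
    dimap-id = identity

    dimap-∘ : (f : X′ ⇒ X) (f′ : X″ ⇒ X′) (g : Y ⇒ Y′) (g′ : Y′ ⇒ Y″) (x : ∣ F ⟦ X , Y ⟧ ∣) →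
              dimap f′ g′ (dimap f g x) ∼ dimap (f ∘ f′) (g′ ∘ g) x
    dimap-∘ f f′ g g′ x = Setoid.sym (F ⟦ _ , _ ⟧) (homomorphism x)

    dimap-square : {X₁ X₂ X₃ X₄ Y₁ Y₂ Y₃ Y₄ : Obj}
                   {f : X₂ ⇒ X₁} {f′ : X₄ ⇒ X₂} {g : Y₁ ⇒ Y₂} {g′ : Y₂ ⇒ Y₄}
                   {h : X₃ ⇒ X₁} {h′ : X₄ ⇒ X₃} {k : Y₁ ⇒ Y₃} {k′ : Y₃ ⇒ Y₄} →
                   f ∘ f′ ≈ h ∘ h′ → g′ ∘ g ≈ k′ ∘ k → (x : ∣ F ⟦ X₁ , Y₁ ⟧ ∣) →
                   dimap f′ g′ (dimap f g x) ∼ dimap h′ k′ (dimap h k x)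
    dimap-square {X₄ = X₄} {Y₄ = Y₄} p q x = begin
      dimap _ _ (dimap _ _ x) ≈⟨ dimap-∘ _ _ _ _ x ⟩
      dimap _ _ x             ≈⟨ dimap-resp p q x ⟩
      dimap _ _ x             ≈⟨ dimap-∘ _ _ _ _ x ⟨
      dimap _ _ (dimap _ _ x) ∎
      where open SetoidReasoning (F ⟦ X₄ , Y₄ ⟧)

  private
    swap : (F : Profunctor) (f : X′ ⇒ X) (g : Y ⇒ Y′) (x : ∣ F ⟦ X , Y ⟧ ∣) →
           Setoid._≈_ (F ⟦ X′ , Y′ ⟧) (dimap F f id (dimap F id g x)) (dimap F id g (dimap F f id x))
    swap F f g = dimap-square F (Equiv.trans identityˡ (Equiv.sym identityʳ))
                                (Equiv.trans identityˡ (Equiv.sym identityʳ))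

  -- ∫^P H(P,P) : the disjoint union of the sets H(P,P) modulo the equivalence
  -- relation generated by H(f,id)(x) ∼ H(id,f)(x) for f : P → Q, x ∈ H(Q,P).
  module _ (H : Profunctor) where

    data CoendStep : (x y : Σ[ P ∈ Obj ] ∣ H ⟦ P , P ⟧ ∣) → Set ℓ where
      equal : ∀ {P x y} → Setoid._≈_ (H ⟦ P , P ⟧) x y → CoendStep (P , x) (P , y)
      glue  : ∀ {P Q} (f : P ⇒ Q) (x : ∣ H ⟦ Q , P ⟧ ∣) →
              CoendStep (P , dimap H f id x) (Q , dimap H id f x)

    Coend : Setoid ℓ ℓ
    Coend = EqC.setoid CoendStep

    -- ∫_P H(P,P) : the set of dinatural families.
    record EndElem : Set ℓ where
      field
        comp  : ∀ P → ∣ H ⟦ P , P ⟧ ∣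
        wedge : ∀ {P Q} (f : P ⇒ Q) →
                Setoid._≈_ (H ⟦ P , Q ⟧) (dimap H id f (comp P)) (dimap H f id (comp Q))

    End : Setoid ℓ ℓ
    End = record
      { Carrier       = EndElem
      ; _≈_           = λ s t → ∀ P → Setoid._≈_ (H ⟦ P , P ⟧) (comp s P) (comp t P)
      ; isEquivalence = record
        { refl  = λ P → Setoid.refl (H ⟦ P , P ⟧)
        ; sym   = λ p P → Setoid.sym (H ⟦ P , P ⟧) (p P)
        ; trans = λ p q P → Setoid.trans (H ⟦ P , P ⟧) (p P) (q P)
        }
      } where open EndElem

  open EndElem public

  coend-equal : (H : Profunctor) {P : Obj} {x y : ∣ H ⟦ P , P ⟧ ∣} →
                Setoid._≈_ (H ⟦ P , P ⟧) x y → Setoid._≈_ (Coend H) (P , x) (P , y)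
  coend-equal H p = fwd (equal p) ◅ ε

  coend-glue : (H : Profunctor) {P Q : Obj} (f : P ⇒ Q) (x : ∣ H ⟦ Q , P ⟧ ∣) →
               Setoid._≈_ (Coend H) (P , dimap H f id x) (Q , dimap H id f x)
  coend-glue H f x = fwd (glue f x) ◅ ε

  coend-rec : (H : Profunctor) (S : Setoid ℓ ℓ)
              (φ : ∀ P → Func (H ⟦ P , P ⟧) S) →
              (∀ {P Q} (f : P ⇒ Q) (x : ∣ H ⟦ Q , P ⟧ ∣) →
                 Setoid._≈_ S (φ P ⟨$⟩ dimap H f id x) (φ Q ⟨$⟩ dimap H id f x)) →
              Func (Coend H) S
  coend-rec H S φ φ-glue = record
    { to   = λ (P , x) → φ P ⟨$⟩ x
    ; cong = EqC.gfold (Setoid.isEquivalence S) (λ (P , x) → φ P ⟨$⟩ x) step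
    }
    where
    step : ∀ {x y} → CoendStep H x y →
           Setoid._≈_ S (φ (proj₁ x) ⟨$⟩ proj₂ x) (φ (proj₁ y) ⟨$⟩ proj₂ y)
    step (equal p)  = Func.cong (φ _) p
    step (glue f x) = φ-glue f x

  HomP : Profunctor
  HomP = record
    { F₀           = λ (X , Y) → hom-setoid X Y
    ; F₁           = λ (f , g) → record
      { to   = λ h → g ∘ (h ∘ f)
      ; cong = λ p → ∘-resp-≈ Equiv.refl (∘-resp-≈ p Equiv.refl) }
    ; identity     = λ h → Equiv.trans identityˡ identityʳ
    ; homomorphism = λ h → Equiv.trans assoc
                          (∘-resp-≈ Equiv.refl
                          (Equiv.trans (∘-resp-≈ Equiv.refl (Equiv.sym assoc))
                                       (Equiv.sym assoc)))
    ; F-resp-≈     = λ (p , q) h → ∘-resp-≈ q (∘-resp-≈ Equiv.refl p)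
    }

  -- The coend in P of this profunctor is (F ⊗ G)(X,Y) = ∫^P F(X,P) × G(P,Y).
  tensorIntegrand : Profunctor → Profunctor → Obj → Obj → Profunctor
  tensorIntegrand F G X Y = record
    { F₀           = λ (P′ , P) → ×-setoid (F ⟦ X , P ⟧) (G ⟦ P′ , Y ⟧)
    ; F₁           = λ (f , g) → record
      { to   = λ (x , y) → dimap F id g x , dimap G f id y
      ; cong = λ (p , q) → dimap-cong F p , dimap-cong G q }
    ; identity     = λ (x , y) → dimap-id F x , dimap-id G y
    ; homomorphism = λ { {X = A} {Y = B} {Z = D} {f = f} {g = g} (x , y) →
        Setoid.sym (F ⟦ _ , _ ⟧)
          (Setoid.trans (F ⟦ _ , _ ⟧) (dimap-∘ F id id (proj₂ f) (proj₂ g) x)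
                                      (dimap-resp F identityˡ Equiv.refl x))
      , Setoid.sym (G ⟦ _ , _ ⟧)
          (Setoid.trans (G ⟦ _ , _ ⟧) (dimap-∘ G (proj₁ f) (proj₁ g) id id y)
                                      (dimap-resp G Equiv.refl identityˡ y)) }
    ; F-resp-≈     = λ (p , q) (x , y) → dimap-resp F Equiv.refl q x , dimap-resp G p Equiv.refl y
    }

  module _ (F G : Profunctor) where

    private
      T : Obj → Obj → Setoid ℓ ℓ
      T X Y = Coend (tensorIntegrand F G X Y)

    tensor₁ : X′ ⇒ X → Y ⇒ Y′ → Func (T X Y) (T X′ Y′)
    tensor₁ {X′} {X} {Y} {Y′} f g =
      coend-rec (tensorIntegrand F G X Y) (T X′ Y′)
        (λ P → record
          { to   = λ (x , y) → P , dimap F f id x , dimap G id g y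
          ; cong = λ (p , q) → coend-equal K (dimap-cong F p , dimap-cong G q) })
        (λ {P} {Q} h (x , y) → begin
          P , dimap F f id (dimap F id id x) , dimap G id g (dimap G h id y)
            ≈⟨ coend-equal K
                 ( dimap-square F (Equiv.trans identityˡ (Equiv.sym identityʳ)) Equiv.refl x
                 , Setoid.sym (G ⟦ _ , _ ⟧) (swap G h g y)) ⟩
          P , dimap F id id (dimap F f id x) , dimap G h id (dimap G id g y)
            ≈⟨ coend-glue K h (dimap F f id x , dimap G id g y) ⟩
          Q , dimap F id h (dimap F f id x) , dimap G id id (dimap G id g y)
            ≈⟨ coend-equal K
                 ( Setoid.sym (F ⟦ _ , _ ⟧) (swap F f h x)
                 , dimap-square G Equiv.refl (Equiv.trans identityˡ (Equiv.sym identityʳ)) y) ⟩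
          Q , dimap F f id (dimap F id h x) , dimap G id g (dimap G id id y) ∎)
      where
      K = tensorIntegrand F G X′ Y′
      open SetoidReasoning (T X′ Y′)

    infixr 6 _⊗_
    _⊗_ : Profunctor
    _⊗_ = record
      { F₀           = λ (X , Y) → T X Y
      ; F₁           = λ (f , g) → tensor₁ f g
      ; identity     = λ { {X , Y} (P , x , y) →
          coend-equal (tensorIntegrand F G X Y) (dimap-id F x , dimap-id G y) }
      ; homomorphism = λ { {Z = X , Y} (P , x , y) →
          coend-equal (tensorIntegrand F G X Y)
            ( Setoid.sym (F ⟦ _ , _ ⟧)
                (Setoid.trans (F ⟦ _ , _ ⟧) (dimap-∘ F _ _ _ _ x)
                                            (dimap-resp F Equiv.refl identityˡ x))
            , Setoid.sym (G ⟦ _ , _ ⟧)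
                (Setoid.trans (G ⟦ _ , _ ⟧) (dimap-∘ G _ _ _ _ y)
                                            (dimap-resp G identityˡ Equiv.refl y))) }
      ; F-resp-≈     = λ { {B = X , Y} (p , q) (P , x , y) →
          coend-equal (tensorIntegrand F G X Y)
            (dimap-resp F p Equiv.refl x , dimap-resp G Equiv.refl q y) }
      }

  module _ {F G : Profunctor} (θ : Pro [ F , G ]) where
    open NatTrans θ

    app : ∣ F ⟦ X , Y ⟧ ∣ → ∣ G ⟦ X , Y ⟧ ∣
    app {X} {Y} x = η (X , Y) ⟨$⟩ x

    app-cong : {x x′ : ∣ F ⟦ X , Y ⟧ ∣} → Setoid._≈_ (F ⟦ X , Y ⟧) x x′ →
               Setoid._≈_ (G ⟦ X , Y ⟧) (app x) (app x′)
    app-cong = Func.cong (η _)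

    app-natural : (f : X′ ⇒ X) (g : Y ⇒ Y′) (x : ∣ F ⟦ X , Y ⟧ ∣) →
                  Setoid._≈_ (G ⟦ X′ , Y′ ⟧) (app (dimap F f g x)) (dimap G f g (app x))
    app-natural f g = commute (f , g)

  -- The class [x,y]_P.
  class : (F G : Profunctor) (P : Obj) → ∣ F ⟦ X , P ⟧ ∣ → ∣ G ⟦ P , Y ⟧ ∣ → ∣ (F ⊗ G) ⟦ X , Y ⟧ ∣
  class F G P x y = P , x , y

  infixr 6 _⊗₁_
  _⊗₁_ : {F F′ G G′ : Profunctor} → Pro [ F , F′ ] → Pro [ G , G′ ] → Pro [ F ⊗ G , F′ ⊗ G′ ]
  _⊗₁_ {F} {F′} {G} {G′} θ φ = record
    { η       = λ (X , Y) → coend-rec (tensorIntegrand F G X Y) ((F′ ⊗ G′) ⟦ X , Y ⟧)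
        (λ P → record
          { to   = λ (x , y) → P , app θ x , app φ y
          ; cong = λ (p , q) →
              coend-equal (tensorIntegrand F′ G′ X Y) (app-cong θ p , app-cong φ q) })
        (λ {P} {Q} h (x , y) → let K = tensorIntegrand F′ G′ X Y
                                   open SetoidReasoning (Coend K) in begin
          P , app θ (dimap F id id x) , app φ (dimap G h id y)
            ≈⟨ coend-equal K (app-natural θ id id x , app-natural φ h id y) ⟩
          P , dimap F′ id id (app θ x) , dimap G′ h id (app φ y)
            ≈⟨ coend-glue K h (app θ x , app φ y) ⟩
          Q , dimap F′ id h (app θ x) , dimap G′ id id (app φ y)
            ≈⟨ coend-equal K (app-natural θ id h x , app-natural φ id id y) ⟨
          Q , app θ (dimap F id h x) , app φ (dimap G id id y) ∎)
    ; commute = λ { {Y = X , Y} (f , g) (P , x , y) →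
        coend-equal (tensorIntegrand F′ G′ X Y) (app-natural θ f id x , app-natural φ id g y) }
    }

  -- [f,y] ↦ F(f,id)(y)
  unitˡ : (F : Profunctor) → Pro [ HomP ⊗ F , F ]
  unitˡ F = record
    { η       = λ (X , Y) → coend-rec (tensorIntegrand HomP F X Y) (F ⟦ X , Y ⟧)
        (λ P → record
          { to   = λ (f , y) → dimap F f id y
          ; cong = λ {x} {x′} (p , q) → Setoid.trans (F ⟦ _ , _ ⟧)
              (dimap-cong F q) (dimap-resp F p Equiv.refl (proj₂ x′)) })
        (λ {P} {Q} h (f , y) → dimap-square F
          (∘-resp-≈ Equiv.refl (Equiv.trans identityˡ identityʳ)
            ⟫ Equiv.sym (Equiv.trans identityˡ (∘-resp-≈ Equiv.refl identityʳ)))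
          Equiv.refl y)
    ; commute = λ { (f , g) (P , h , y) → dimap-square F
        (Equiv.trans identityˡ identityˡ)
        (Equiv.trans identityˡ (Equiv.sym identityʳ)) y }
    }
    where
    infixr 4 _⟫_
    _⟫_ : ∀ {A B} {f g h : A ⇒ B} → f ≈ g → g ≈ h → f ≈ h
    _⟫_ = Equiv.trans

  -- [x,g] ↦ F(id,g)(x)
  unitʳ : (F : Profunctor) → Pro [ F ⊗ HomP , F ]
  unitʳ F = record
    { η       = λ (X , Y) → coend-rec (tensorIntegrand F HomP X Y) (F ⟦ X , Y ⟧)
        (λ P → record
          { to   = λ (x , g) → dimap F id g x
          ; cong = λ {x} {x′} (p , q) → Setoid.trans (F ⟦ _ , _ ⟧)
              (dimap-cong F p) (dimap-resp F Equiv.refl q (proj₁ x′)) })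
        (λ {P} {Q} h (x , g) → dimap-square F
          Equiv.refl
          (Equiv.trans identityʳ (Equiv.trans identityˡ
            (Equiv.sym (∘-resp-≈ (Equiv.trans identityˡ identityʳ) Equiv.refl))))
          x)
    ; commute = λ { (f , g) (P , x , h) → dimap-square F
        (Equiv.trans identityʳ (Equiv.sym identityˡ))
        (Equiv.trans identityʳ (∘-resp-≈ Equiv.refl identityʳ)) x }
    }

  -- [[x,y],z] ↦ [x,[y,z]]
  associator : (F G H : Profunctor) → Pro [ (F ⊗ G) ⊗ H , F ⊗ (G ⊗ H) ]
  associator F G H = record
    { η       = λ (X , Y) → coend-rec (tensorIntegrand (F ⊗ G) H X Y) ((F ⊗ (G ⊗ H)) ⟦ X , Y ⟧)
        (λ Q → record
          { to   = λ (xy , z) → fixed z ⟨$⟩ xy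
          ; cong = λ { {xy , z} {(P , x , y) , z′} (p , q) →
              Setoid.trans ((F ⊗ (G ⊗ H)) ⟦ X , Y ⟧)
                (Func.cong (fixed z) p)
                (coend-equal (tensorIntegrand F (G ⊗ H) X Y)
                  ( Setoid.refl (F ⟦ _ , _ ⟧)
                  , coend-equal (tensorIntegrand G H _ Y) (Setoid.refl (G ⟦ _ , _ ⟧) , q))) } })
        (λ { h ((P , x , y) , z) → coend-equal (tensorIntegrand F (G ⊗ H) X Y)
          (Setoid.refl (F ⟦ _ , _ ⟧) , coend-glue (tensorIntegrand G H _ Y) h (y , z)) })
    ; commute = λ { {Y = X , Y} (f , g) ((Q , (P , x , y) , z)) →
        coend-equal (tensorIntegrand F (G ⊗ H) X Y)
          ( Setoid.refl (F ⟦ _ , _ ⟧)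
          , coend-equal (tensorIntegrand G H _ Y)
              (Setoid.refl (G ⟦ _ , _ ⟧) , Setoid.refl (H ⟦ _ , _ ⟧))) }
    }
    where
    fixed : ∀ {X Q Y} → ∣ H ⟦ Q , Y ⟧ ∣ → Func ((F ⊗ G) ⟦ X , Q ⟧) ((F ⊗ (G ⊗ H)) ⟦ X , Y ⟧)
    fixed {X} {Q} {Y} z = coend-rec (tensorIntegrand F G X Q) ((F ⊗ (G ⊗ H)) ⟦ X , Y ⟧)
      (λ P → record
        { to   = λ (x , y) → P , x , (Q , y , z)
        ; cong = λ (p , q) → coend-equal K
            (p , coend-equal (tensorIntegrand G H P Y) (q , Setoid.refl (H ⟦ _ , _ ⟧))) })
      (λ {P} {P′} h (x , y) → begin
        P , dimap F id id x , (Q , dimap G h id y , z)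
          ≈⟨ coend-equal K
               ( Setoid.refl (F ⟦ _ , _ ⟧)
               , coend-equal (tensorIntegrand G H P Y)
                   (Setoid.refl (G ⟦ _ , _ ⟧) , Setoid.sym (H ⟦ _ , _ ⟧) (dimap-id H z))) ⟩
        P , dimap F id id x , (Q , dimap G h id y , dimap H id id z)
          ≈⟨ coend-glue K h (x , (Q , y , z)) ⟩
        P′ , dimap F id h x , (Q , dimap G id id y , dimap H id id z)
          ≈⟨ coend-equal K
               ( Setoid.refl (F ⟦ _ , _ ⟧)
               , coend-equal (tensorIntegrand G H P′ Y)
                   (Setoid.refl (G ⟦ _ , _ ⟧) , dimap-id H z)) ⟩
        P′ , dimap F id h x , (Q , dimap G id id y , z) ∎)
      where
      K = tensorIntegrand F (G ⊗ H) X Y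
      open SetoidReasoning (Coend K)

  -- B^A(X,Y) = Nat(A(Y,-),B(X,-)) is the end ∫_D A(Y,D) → B(X,D) of this profunctor.
  expIntegrand : Profunctor → Profunctor → Obj → Obj → Profunctor
  expIntegrand B A X Y = record
    { F₀           = λ (D′ , D) → FuncEq.setoid (A ⟦ Y , D′ ⟧) (B ⟦ X , D ⟧)
    ; F₁           = λ (f , g) → record
      { to   = λ φ → record
        { to   = λ a → dimap B id g (φ ⟨$⟩ dimap A id f a)
        ; cong = λ p → dimap-cong B (Func.cong φ (dimap-cong A p)) }
      ; cong = λ p a → dimap-cong B (p (dimap A id f a)) }
    ; identity     = λ φ a → Setoid.trans (B ⟦ _ , _ ⟧) (dimap-id B _) (Func.cong φ (dimap-id A a))
    ; homomorphism = λ { {f = f , g} {g = f′ , g′} φ a → Setoid.sym (B ⟦ _ , _ ⟧)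
        (Setoid.trans (B ⟦ _ , _ ⟧)
          (dimap-∘ B id id g g′ _)
          (Setoid.trans (B ⟦ _ , _ ⟧)
            (dimap-resp B identityˡ Equiv.refl _)
            (dimap-cong B (Func.cong φ
              (Setoid.trans (A ⟦ _ , _ ⟧)
                (dimap-∘ A id id f′ f a)
                (dimap-resp A identityˡ Equiv.refl a)))))) }
    ; F-resp-≈     = λ (p , q) φ a → Setoid.trans (B ⟦ _ , _ ⟧)
        (dimap-resp B Equiv.refl q _)
        (dimap-cong B (Func.cong φ (dimap-resp A Equiv.refl p a)))
    }

  infixl 8 _^_
  _^_ : Profunctor → Profunctor → Profunctor
  B ^ A = record
    { F₀           = λ (X , Y) → End (expIntegrand B A X Y)
    ; F₁           = λ (f , g) → record
      { to   = λ t → record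
        { comp  = λ D → record
          { to   = λ a → dimap B f id (comp t D ⟨$⟩ dimap A g id a)
          ; cong = λ p → dimap-cong B (Func.cong (comp t D) (dimap-cong A p)) }
        ; wedge = λ {P} {Q} h a → let open SetoidReasoning (B ⟦ _ , Q ⟧) in begin
            dimap B id h (dimap B f id (comp t P ⟨$⟩ dimap A g id (dimap A id id a)))
              ≈⟨ swap B f h _ ⟨
            dimap B f id (dimap B id h (comp t P ⟨$⟩ dimap A g id (dimap A id id a)))
              ≈⟨ dimap-cong B (dimap-cong B (Func.cong (comp t P) (swap A g id a))) ⟩
            dimap B f id (dimap B id h (comp t P ⟨$⟩ dimap A id id (dimap A g id a)))
              ≈⟨ dimap-cong B (wedge t h (dimap A g id a)) ⟩
            dimap B f id (dimap B id id (comp t Q ⟨$⟩ dimap A id h (dimap A g id a)))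
              ≈⟨ dimap-cong B (dimap-cong B (Func.cong (comp t Q) (swap A g h a))) ⟨
            dimap B f id (dimap B id id (comp t Q ⟨$⟩ dimap A g id (dimap A id h a)))
              ≈⟨ swap B f id _ ⟩
            dimap B id id (dimap B f id (comp t Q ⟨$⟩ dimap A g id (dimap A id h a))) ∎ }
      ; cong = λ p D a → dimap-cong B (p D (dimap A _ id a)) }
    ; identity     = λ t D a → Setoid.trans (B ⟦ _ , _ ⟧) (dimap-id B _)
                                 (Func.cong (comp t D) (dimap-id A a))
    ; homomorphism = λ { {f = f , g} {g = f′ , g′} t D a → Setoid.sym (B ⟦ _ , _ ⟧)
        (Setoid.trans (B ⟦ _ , _ ⟧)
          (dimap-∘ B f f′ id id _)
          (Setoid.trans (B ⟦ _ , _ ⟧)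
            (dimap-resp B Equiv.refl identityˡ _)
            (dimap-cong B (Func.cong (comp t D)
              (Setoid.trans (A ⟦ _ , _ ⟧)
                (dimap-∘ A g′ g id id a)
                (dimap-resp A Equiv.refl identityˡ a)))))) }
    ; F-resp-≈     = λ (p , q) t D a → Setoid.trans (B ⟦ _ , _ ⟧)
        (dimap-resp B p Equiv.refl _)
        (dimap-cong B (Func.cong (comp t D) (dimap-resp A q Equiv.refl a)))
    }

module StrongProfunctors {ℓ} (C : Category ℓ ℓ) (ccc : CartesianClosed C) where
  open Category C
  open CartesianClosed ccc
  open Profunctors C public

  private
    variable
      X X′ Y Y′ : Obj

    infixr 4 _▸_
    _▸_ : ∀ {A B} {f g h : A ⇒ B} → f ≈ g → g ≈ h → f ≈ h
    _▸_ = Equiv.trans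

  record Strength (F : Profunctor) : Set ℓ where
    no-eta-equality
    private
      infix 4 _∼_
      _∼_ : ∣ F ⟦ X , Y ⟧ ∣ → ∣ F ⟦ X , Y ⟧ ∣ → Set ℓ
      _∼_ {X} {Y} = Setoid._≈_ (F ⟦ X , Y ⟧)
    field
      st        : ∀ Z → ∣ F ⟦ X , Y ⟧ ∣ → ∣ F ⟦ X ⊠ Z , Y ⊠ Z ⟧ ∣
      st-cong   : ∀ {Z} {x x′ : ∣ F ⟦ X , Y ⟧ ∣} → x ∼ x′ → st Z x ∼ st Z x′
      natural   : ∀ {Z} (f : X′ ⇒ X) (g : Y ⇒ Y′) (x : ∣ F ⟦ X , Y ⟧ ∣) →
                  st Z (dimap F f g x) ∼ dimap F (f ⊠₁ id) (g ⊠₁ id) (st Z x)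
      dinatural : ∀ {Z W} (h : Z ⇒ W) (x : ∣ F ⟦ X , Y ⟧ ∣) →
                  dimap F id (id ⊠₁ h) (st Z x) ∼ dimap F (id ⊠₁ h) id (st W x)
      st-unit   : (x : ∣ F ⟦ X , Y ⟧ ∣) → dimap F id π₁ (st 𝟙 x) ∼ dimap F π₁ id x
      st-assoc  : ∀ {V W} (x : ∣ F ⟦ X , Y ⟧ ∣) →
                  st W (st V x) ∼ dimap F α α⁻¹ (st (V ⊠ W) x)

  {-# INLINE Strength.constructor #-}

  record StrongProfunctor : Set (lsuc ℓ) where
    no-eta-equality
    constructor _,ₛ_
    field
      profunctor : Profunctor
      strength   : Strength profunctor
    open Strength strength public

  {-# INLINE _,ₛ_ #-}

  open StrongProfunctor using (profunctor; st)

  record StrongNatTrans (F G : StrongProfunctor) : Set ℓ where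
    no-eta-equality
    field
      natTrans : Pro [ profunctor F , profunctor G ]
      strong   : ∀ {X Y} Z (x : ∣ profunctor F ⟦ X , Y ⟧ ∣) →
                 Setoid._≈_ (profunctor G ⟦ X ⊠ Z , Y ⊠ Z ⟧)
                   (app natTrans (st F Z x)) (st G Z (app natTrans x))

  {-# INLINE StrongNatTrans.constructor #-}

  SPro : Category (lsuc ℓ) ℓ
  SPro = record
    { Obj       = StrongProfunctor
    ; _⇒_       = StrongNatTrans
    ; _≈_       = λ θ φ → natTrans θ P.≈ natTrans φ
    ; id        = λ {F} → record
      { natTrans = P.id
      ; strong   = λ Z x → Setoid.refl (profunctor F ⟦ _ , _ ⟧) }
    ; _∘_       = λ {F} {G} {H} θ φ → record
      { natTrans = natTrans θ P.∘ natTrans φ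
      ; strong   = λ Z x → Setoid.trans (profunctor H ⟦ _ , _ ⟧)
          (app-cong (natTrans θ) (strong φ Z x))
          (strong θ Z (app (natTrans φ) x)) }
    ; assoc     = λ {_} {_} {_} {_} {f} {g} {h} →
                    P.assoc {f = natTrans f} {natTrans g} {natTrans h}
    ; identityˡ = λ {_} {_} {f} → P.identityˡ {f = natTrans f}
    ; identityʳ = λ {_} {_} {f} → P.identityʳ {f = natTrans f}
    ; equiv     = On.isEquivalence natTrans P.equiv
    ; ∘-resp-≈  = λ {_} {_} {_} {f} {f′} {g} {g′} →
                    P.∘-resp-≈ {f = natTrans f} {natTrans f′} {natTrans g} {natTrans g′}
    }
    where
    module P = Category Pro
    open StrongNatTrans

  U : Functor SPro Pro
  U = record
    { F₀           = profunctor
    ; F₁           = StrongNatTrans.natTrans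
    ; identity     = λ {F} _ _ → Setoid.refl (profunctor F ⟦ _ , _ ⟧)
    ; homomorphism = λ {_} {_} {H} _ _ → Setoid.refl (profunctor H ⟦ _ , _ ⟧)
    ; F-resp-≈     = λ p → p
    }

  HomS : StrongProfunctor
  HomS = HomP ,ₛ record
    { st        = λ Z f → f ⊠₁ id
    ; st-cong   = λ p → ⊠₁-cong p Equiv.refl
    ; natural   = λ f g h →
        ⊠₁-cong Equiv.refl (Equiv.sym (identityˡ ▸ identityˡ))
        ▸ ⊠₁-∘ ▸ ∘-resp-≈ Equiv.refl ⊠₁-∘
    ; dinatural = λ h f →
        ∘-resp-≈ Equiv.refl identityʳ
        ▸ Equiv.sym ⊠₁-∘
        ▸ ⊠₁-cong (identityˡ ▸ Equiv.sym identityʳ) (identityʳ ▸ Equiv.sym identityˡ)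
        ▸ ⊠₁-∘
        ▸ Equiv.sym identityˡ
    ; st-unit   = λ f → ∘-resp-≈ Equiv.refl identityʳ ▸ project₁ ▸ Equiv.sym identityˡ
    ; st-assoc  = λ f → Equiv.sym
        ( ∘-resp-≈ Equiv.refl
            (∘-resp-≈ (⊠₁-cong Equiv.refl (Equiv.sym ⊠₁-id)) Equiv.refl ▸ Equiv.sym α-natural)
        ▸ Equiv.sym assoc ▸ ∘-resp-≈ α⁻¹∘α Equiv.refl ▸ identityˡ)
    }

  module _ (F G : StrongProfunctor) where
    private
      module F = StrongProfunctor F
      module G = StrongProfunctor G
      F₀ = F.profunctor
      G₀ = G.profunctor

    -- [x,y]_P ↦ [st x, st y]_{P × Z}
    st⊗ : ∀ {X Y} Z → Func ((F₀ ⊗ G₀) ⟦ X , Y ⟧) ((F₀ ⊗ G₀) ⟦ X ⊠ Z , Y ⊠ Z ⟧)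
    st⊗ {X} {Y} Z = coend-rec (tensorIntegrand F₀ G₀ X Y) ((F₀ ⊗ G₀) ⟦ X ⊠ Z , Y ⊠ Z ⟧)
      (λ P → record
        { to   = λ (x , y) → P ⊠ Z , F.st Z x , G.st Z y
        ; cong = λ (p , q) → coend-equal K (F.st-cong p , G.st-cong q) })
      (λ {P} {Q} h (x , y) → begin
        P ⊠ Z , F.st Z (dimap F₀ id id x) , G.st Z (dimap G₀ h id y)
          ≈⟨ coend-equal K
               ( Setoid.trans (F₀ ⟦ _ , _ ⟧) (F.natural id id x) (dimap-resp F₀ ⊠₁-id ⊠₁-id _)
               , Setoid.trans (G₀ ⟦ _ , _ ⟧) (G.natural h id y)
                                             (dimap-resp G₀ Equiv.refl ⊠₁-id _)) ⟩
        P ⊠ Z , dimap F₀ id id (F.st Z x) , dimap G₀ (h ⊠₁ id) id (G.st Z y)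
          ≈⟨ coend-glue K (h ⊠₁ id) (F.st Z x , G.st Z y) ⟩
        Q ⊠ Z , dimap F₀ id (h ⊠₁ id) (F.st Z x) , dimap G₀ id id (G.st Z y)
          ≈⟨ coend-equal K
               ( Setoid.trans (F₀ ⟦ _ , _ ⟧) (F.natural id h x)
                                             (dimap-resp F₀ ⊠₁-id Equiv.refl _)
               , Setoid.trans (G₀ ⟦ _ , _ ⟧) (G.natural id id y) (dimap-resp G₀ ⊠₁-id ⊠₁-id _)) ⟨
        Q ⊠ Z , F.st Z (dimap F₀ id h x) , G.st Z (dimap G₀ id id y) ∎)
      where
      K = tensorIntegrand F₀ G₀ (X ⊠ Z) (Y ⊠ Z)
      open SetoidReasoning (Coend K)

    -- [x, G(f,id)(y)] = [F(id,f)(x), y]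
    private
      slide : ∀ {P Q} (f : P ⇒ Q) (x : ∣ F₀ ⟦ X , P ⟧ ∣) (y : ∣ G₀ ⟦ Q , Y ⟧ ∣) →
              Setoid._≈_ ((F₀ ⊗ G₀) ⟦ X , Y ⟧) (P , x , dimap G₀ f id y) (Q , dimap F₀ id f x , y)
      slide {X} {Y} {P} {Q} f x y = begin
        P , x , dimap G₀ f id y
          ≈⟨ coend-equal K (dimap-id F₀ x , Setoid.refl (G₀ ⟦ _ , _ ⟧)) ⟨
        P , dimap F₀ id id x , dimap G₀ f id y
          ≈⟨ coend-glue K f (x , y) ⟩
        Q , dimap F₀ id f x , dimap G₀ id id y
          ≈⟨ coend-equal K (Setoid.refl (F₀ ⟦ _ , _ ⟧) , dimap-id G₀ y) ⟩
        Q , dimap F₀ id f x , y ∎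
        where
        K = tensorIntegrand F₀ G₀ X Y
        open SetoidReasoning (Coend K)

    infixr 6 _⊗ₛ_
    _⊗ₛ_ : StrongProfunctor
    _⊗ₛ_ = (F₀ ⊗ G₀) ,ₛ record
      { st        = λ Z → st⊗ Z ⟨$⟩_
      ; st-cong   = λ {_} {_} {Z} → Func.cong (st⊗ Z)
      ; natural   = λ { {X′} {X} {Y} {Y′} {Z} f g (P , x , y) →
          coend-equal (tensorIntegrand F₀ G₀ (X′ ⊠ Z) (Y′ ⊠ Z))
            ( Setoid.trans (F₀ ⟦ _ , _ ⟧) (F.natural f id x) (dimap-resp F₀ Equiv.refl ⊠₁-id _)
            , Setoid.trans (G₀ ⟦ _ , _ ⟧) (G.natural id g y) (dimap-resp G₀ ⊠₁-id Equiv.refl _)) }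
      ; dinatural = λ { {X} {Y} {Z} {W} h (P , x , y) →
          let K = tensorIntegrand F₀ G₀ (X ⊠ Z) (Y ⊠ W)
              open SetoidReasoning (Coend K) in begin
          P ⊠ Z , dimap F₀ id id (F.st Z x) , dimap G₀ id (id ⊠₁ h) (G.st Z y)
            ≈⟨ coend-equal K (dimap-id F₀ _ , G.dinatural h y) ⟩
          P ⊠ Z , F.st Z x , dimap G₀ (id ⊠₁ h) id (G.st W y)
            ≈⟨ slide (id ⊠₁ h) (F.st Z x) (G.st W y) ⟩
          P ⊠ W , dimap F₀ id (id ⊠₁ h) (F.st Z x) , G.st W y
            ≈⟨ coend-equal K (F.dinatural h x , Setoid.sym (G₀ ⟦ _ , _ ⟧) (dimap-id G₀ _)) ⟩
          P ⊠ W , dimap F₀ (id ⊠₁ h) id (F.st W x) , dimap G₀ id id (G.st W y) ∎ }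
      ; st-unit   = λ { {X} {Y} (P , x , y) →
          let K = tensorIntegrand F₀ G₀ (X ⊠ 𝟙) Y
              open SetoidReasoning (Coend K) in begin
          P ⊠ 𝟙 , dimap F₀ id id (F.st 𝟙 x) , dimap G₀ id π₁ (G.st 𝟙 y)
            ≈⟨ coend-equal K (dimap-id F₀ _ , G.st-unit y) ⟩
          P ⊠ 𝟙 , F.st 𝟙 x , dimap G₀ π₁ id y
            ≈⟨ slide π₁ (F.st 𝟙 x) y ⟩
          P , dimap F₀ id π₁ (F.st 𝟙 x) , y
            ≈⟨ coend-equal K (F.st-unit x , Setoid.sym (G₀ ⟦ _ , _ ⟧) (dimap-id G₀ _)) ⟩
          P , dimap F₀ π₁ id x , dimap G₀ id id y ∎ }
      ; st-assoc  = λ { {X} {Y} {V} {W} (P , x , y) →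
          let K = tensorIntegrand F₀ G₀ ((X ⊠ V) ⊠ W) ((Y ⊠ V) ⊠ W)
              open SetoidReasoning (Coend K) in begin
          (P ⊠ V) ⊠ W , F.st W (F.st V x) , G.st W (G.st V y)
            ≈⟨ coend-equal K (F.st-assoc x , G.st-assoc y) ⟩
          (P ⊠ V) ⊠ W , dimap F₀ α α⁻¹ (F.st (V ⊠ W) x) , dimap G₀ α α⁻¹ (G.st (V ⊠ W) y)
            ≈⟨ coend-equal K
                 ( Setoid.refl (F₀ ⟦ _ , _ ⟧)
                 , Setoid.sym (G₀ ⟦ _ , _ ⟧)
                     (Setoid.trans (G₀ ⟦ _ , _ ⟧)
                       (dimap-∘ G₀ id α α⁻¹ id _)
                       (dimap-resp G₀ identityˡ identityˡ _))) ⟩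
          (P ⊠ V) ⊠ W , dimap F₀ α α⁻¹ (F.st (V ⊠ W) x)
                      , dimap G₀ α id (dimap G₀ id α⁻¹ (G.st (V ⊠ W) y))
            ≈⟨ slide α _ _ ⟩
          P ⊠ (V ⊠ W) , dimap F₀ id α (dimap F₀ α α⁻¹ (F.st (V ⊠ W) x))
                      , dimap G₀ id α⁻¹ (G.st (V ⊠ W) y)
            ≈⟨ coend-equal K
                 ( Setoid.trans (F₀ ⟦ _ , _ ⟧)
                     (dimap-∘ F₀ α id α⁻¹ α _)
                     (dimap-resp F₀ identityʳ α∘α⁻¹ _)
                 , Setoid.refl (G₀ ⟦ _ , _ ⟧)) ⟩
          P ⊠ (V ⊠ W) , dimap F₀ α id (F.st (V ⊠ W) x) , dimap G₀ id α⁻¹ (G.st (V ⊠ W) y) ∎ }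
      }

  infixr 6 _⊗ₛ₁_
  _⊗ₛ₁_ : {F F′ G G′ : StrongProfunctor} →
          SPro [ F , F′ ] → SPro [ G , G′ ] → SPro [ F ⊗ₛ G , F′ ⊗ₛ G′ ]
  _⊗ₛ₁_ {F} {F′} {G} {G′} θ φ = record
    { natTrans = natTrans θ ⊗₁ natTrans φ
    ; strong   = λ { {X} {Y} Z (P , x , y) →
        coend-equal (tensorIntegrand (profunctor F′) (profunctor G′) (X ⊠ Z) (Y ⊠ Z))
          (strong θ Z x , strong φ Z y) }
    } where open StrongNatTrans

  unitˡₛ : (F : StrongProfunctor) → SPro [ HomS ⊗ₛ F , F ]
  unitˡₛ F = record
    { natTrans = unitˡ F.profunctor
    ; strong   = λ { Z (P , f , y) → Setoid.sym (F.profunctor ⟦ _ , _ ⟧)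
        (Setoid.trans (F.profunctor ⟦ _ , _ ⟧)
          (F.natural f id y)
          (dimap-resp F.profunctor Equiv.refl ⊠₁-id _)) }
    } where module F = StrongProfunctor F

  unitʳₛ : (F : StrongProfunctor) → SPro [ F ⊗ₛ HomS , F ]
  unitʳₛ F = record
    { natTrans = unitʳ F.profunctor
    ; strong   = λ { Z (P , x , g) → Setoid.sym (F.profunctor ⟦ _ , _ ⟧)
        (Setoid.trans (F.profunctor ⟦ _ , _ ⟧)
          (F.natural id g x)
          (dimap-resp F.profunctor ⊠₁-id Equiv.refl _)) }
    } where module F = StrongProfunctor F

  associatorₛ : (F G H : StrongProfunctor) → SPro [ (F ⊗ₛ G) ⊗ₛ H , F ⊗ₛ (G ⊗ₛ H) ]
  associatorₛ F G H = record
    { natTrans = associator (profunctor F) (profunctor G) (profunctor H)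
    ; strong   = λ { {X} {Y} Z (Q , (P , x , y) , z) →
        Setoid.refl ((profunctor F ⊗ (profunctor G ⊗ profunctor H)) ⟦ X ⊠ Z , Y ⊠ Z ⟧) }
    }

  record Monoid : Set (lsuc ℓ) where
    private module S = Category SPro
    field
      carrier : StrongProfunctor
      m       : SPro [ carrier ⊗ₛ carrier , carrier ]
      e       : SPro [ HomS , carrier ]
      m-assoc : SPro [ m S.∘ (m ⊗ₛ₁ S.id)
                     ≈ m S.∘ ((S.id ⊗ₛ₁ m) S.∘ associatorₛ carrier carrier carrier) ]
      m-unitˡ : SPro [ m S.∘ (e ⊗ₛ₁ S.id) ≈ unitˡₛ carrier ]
      m-unitʳ : SPro [ m S.∘ (S.id ⊗ₛ₁ e) ≈ unitʳₛ carrier ]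

  private
    α-⟨⟩ : ∀ {W X Y Z} {a : W ⇒ X} {b : W ⇒ Y} {c : W ⇒ Z} →
           α ∘ ⟨ ⟨ a , b ⟩ , c ⟩ ≈ ⟨ a , ⟨ b , c ⟩ ⟩
    α-⟨⟩ = ⟨⟩∘ ▸ ⟨⟩-cong (assoc ▸ ∘-resp-≈ Equiv.refl project₁ ▸ project₁)
                   (⟨⟩∘ ▸ ⟨⟩-cong (assoc ▸ ∘-resp-≈ Equiv.refl project₁ ▸ project₂) project₂)

    α⁻¹-⟨⟩ : ∀ {W X Y Z} {a : W ⇒ X} {b : W ⇒ Y} {c : W ⇒ Z} →
             α⁻¹ ∘ ⟨ a , ⟨ b , c ⟩ ⟩ ≈ ⟨ ⟨ a , b ⟩ , c ⟩
    α⁻¹-⟨⟩ = ∘-resp-≈ Equiv.refl (Equiv.sym α-⟨⟩) ▸ Equiv.sym assoc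
             ▸ ∘-resp-≈ α⁻¹∘α Equiv.refl ▸ identityˡ

    ⟨⟩-η : ∀ {W X Y} {h : W ⇒ X ⊠ Y} → h ≈ ⟨ π₁ ∘ h , π₂ ∘ h ⟩
    ⟨⟩-η = Equiv.sym (⟨⟩-unique Equiv.refl Equiv.refl)

    pentagon : ∀ {X Y Z W} →
               (id ⊠₁ α) ∘ (α ∘ (α ⊠₁ id)) ≈ α ∘ α {X ⊠ Y} {Z} {W}
    pentagon {X} {Y} {Z} {W} = Equiv.sym identityʳ
        ▸ ∘-resp-≈ Equiv.refl tuple
        ▸ (assoc ▸ ∘-resp-≈ Equiv.refl
            (assoc ▸ ∘-resp-≈ Equiv.refl
              (⊠₁∘⟨⟩ ▸ ⟨⟩-cong α-⟨⟩ identityˡ) ▸ α-⟨⟩)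
          ▸ ⊠₁∘⟨⟩ ▸ ⟨⟩-cong identityˡ α-⟨⟩)
        ▸ Equiv.sym (assoc ▸ ∘-resp-≈ Equiv.refl α-⟨⟩ ▸ α-⟨⟩)
        ▸ ∘-resp-≈ Equiv.refl (Equiv.sym tuple)
        ▸ identityʳ
      where
      tuple : id {((X ⊠ Y) ⊠ Z) ⊠ W} ≈ ⟨ ⟨ ⟨ _ , _ ⟩ , _ ⟩ , _ ⟩
      tuple = ⟨⟩-η ▸ ⟨⟩-cong (⟨⟩-η ▸ ⟨⟩-cong ⟨⟩-η Equiv.refl) Equiv.refl

    pentagon⁻¹ : ∀ {X Y Z W} →
                 (α⁻¹ ⊠₁ id) ∘ (α⁻¹ ∘ (id ⊠₁ α⁻¹)) ≈ α⁻¹ {X ⊠ Y} {Z} {W} ∘ α⁻¹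
    pentagon⁻¹ {X} {Y} {Z} {W} = Equiv.sym identityʳ
        ▸ ∘-resp-≈ Equiv.refl tuple
        ▸ (assoc ▸ ∘-resp-≈ Equiv.refl
            (assoc ▸ ∘-resp-≈ Equiv.refl
              (⊠₁∘⟨⟩ ▸ ⟨⟩-cong identityˡ α⁻¹-⟨⟩) ▸ α⁻¹-⟨⟩)
          ▸ ⊠₁∘⟨⟩ ▸ ⟨⟩-cong α⁻¹-⟨⟩ identityˡ)
        ▸ Equiv.sym (assoc ▸ ∘-resp-≈ Equiv.refl α⁻¹-⟨⟩ ▸ α⁻¹-⟨⟩)
        ▸ ∘-resp-≈ Equiv.refl (Equiv.sym tuple)
        ▸ identityʳ
      where
      tuple : id {X ⊠ (Y ⊠ (Z ⊠ W))} ≈ ⟨ _ , ⟨ _ , ⟨ _ , _ ⟩ ⟩ ⟩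
      tuple = ⟨⟩-η ▸ ⟨⟩-cong Equiv.refl (⟨⟩-η ▸ ⟨⟩-cong Equiv.refl ⟨⟩-η)

    ⊠₁-interchange : ∀ {X X′ Y Y′} {f : X ⇒ X′} {g : Y ⇒ Y′} →
                     (f ⊠₁ id) ∘ (id ⊠₁ g) ≈ (id ⊠₁ g) ∘ (f ⊠₁ id)
    ⊠₁-interchange = Equiv.sym ⊠₁-∘
      ▸ ⊠₁-cong (identityʳ ▸ Equiv.sym identityˡ) (identityˡ ▸ Equiv.sym identityʳ)
      ▸ ⊠₁-∘

    id⊠₁-∘ : ∀ {X Y Y′ Y″} {g : Y′ ⇒ Y″} {f : Y ⇒ Y′} →
             (id {X} ⊠₁ g) ∘ (id ⊠₁ f) ≈ id ⊠₁ (g ∘ f)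
    id⊠₁-∘ = Equiv.sym ⊠₁-∘ ▸ ⊠₁-cong identityˡ Equiv.refl

    ⊠₁id-∘ : ∀ {X X′ X″ Y} {g : X′ ⇒ X″} {f : X ⇒ X′} →
             (g ⊠₁ id {Y}) ∘ (f ⊠₁ id) ≈ (g ∘ f) ⊠₁ id
    ⊠₁id-∘ = Equiv.sym ⊠₁-∘ ▸ ⊠₁-cong Equiv.refl identityˡ

  -- T_B(X,Y) = ∫_Z B(X × Z, Y × Z) is the end of this profunctor.
  tIntegrand : Profunctor → Obj → Obj → Profunctor
  tIntegrand B X Y = record
    { F₀           = λ (Z′ , Z) → B ⟦ X ⊠ Z′ , Y ⊠ Z ⟧
    ; F₁           = λ (f , g) → record
      { to   = dimap B (id ⊠₁ f) (id ⊠₁ g)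
      ; cong = dimap-cong B }
    ; identity     = λ b → Setoid.trans (B ⟦ _ , _ ⟧) (dimap-resp B ⊠₁-id ⊠₁-id b) (dimap-id B b)
    ; homomorphism = λ b → Setoid.sym (B ⟦ _ , _ ⟧)
        (Setoid.trans (B ⟦ _ , _ ⟧) (dimap-∘ B _ _ _ _ b) (dimap-resp B id⊠₁-∘ id⊠₁-∘ b))
    ; F-resp-≈     = λ (p , q) → dimap-resp B (⊠₁-cong Equiv.refl p) (⊠₁-cong Equiv.refl q)
    }

  T₀ : Profunctor → Profunctor
  T₀ B = record
    { F₀           = λ (X , Y) → End (tIntegrand B X Y)
    ; F₁           = λ (f , g) → record
      { to   = λ t → record
        { comp  = λ Z → dimap B (f ⊠₁ id) (g ⊠₁ id) (comp t Z)
        ; wedge = λ {P} {Q} h → let open SetoidReasoning (B ⟦ _ , _ ⟧) in begin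
            dimap B (id ⊠₁ id) (id ⊠₁ h) (dimap B (f ⊠₁ id) (g ⊠₁ id) (comp t P))
              ≈⟨ dimap-square B (Equiv.sym ⊠₁-interchange′) (Equiv.sym ⊠₁-interchange) _ ⟩
            dimap B (f ⊠₁ id) (g ⊠₁ id) (dimap B (id ⊠₁ id) (id ⊠₁ h) (comp t P))
              ≈⟨ dimap-cong B (wedge t h) ⟩
            dimap B (f ⊠₁ id) (g ⊠₁ id) (dimap B (id ⊠₁ h) (id ⊠₁ id) (comp t Q))
              ≈⟨ dimap-square B ⊠₁-interchange″ ⊠₁-interchange _ ⟩
            dimap B (id ⊠₁ h) (id ⊠₁ id) (dimap B (f ⊠₁ id) (g ⊠₁ id) (comp t Q)) ∎ }
      ; cong = λ p Z → dimap-cong B (p Z) }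
    ; identity     = λ t Z → Setoid.trans (B ⟦ _ , _ ⟧)
                               (dimap-resp B ⊠₁-id ⊠₁-id _) (dimap-id B _)
    ; homomorphism = λ t Z → Setoid.sym (B ⟦ _ , _ ⟧)
        (Setoid.trans (B ⟦ _ , _ ⟧) (dimap-∘ B _ _ _ _ _) (dimap-resp B ⊠₁id-∘ ⊠₁id-∘ _))
    ; F-resp-≈     = λ (p , q) t Z →
        dimap-resp B (⊠₁-cong p Equiv.refl) (⊠₁-cong q Equiv.refl) _
    }
    where
    ⊠₁-interchange′ : ∀ {X X′ Y} {f : X ⇒ X′} →
                      (id ⊠₁ id {Y}) ∘ (f ⊠₁ id) ≈ (f ⊠₁ id) ∘ (id ⊠₁ id)
    ⊠₁-interchange′ = Equiv.sym ⊠₁-interchange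
    ⊠₁-interchange″ : ∀ {X X′ Y Y′} {f : X ⇒ X′} {g : Y ⇒ Y′} →
                      (id ⊠₁ g) ∘ (f ⊠₁ id) ≈ (f ⊠₁ id) ∘ (id ⊠₁ g)
    ⊠₁-interchange″ = Equiv.sym ⊠₁-interchange

  -- (st_Z(t))_V = B(α,α⁻¹)(t_{Z × V})
  stT : (B : Profunctor) (Z : Obj) → ∣ T₀ B ⟦ X , Y ⟧ ∣ → ∣ T₀ B ⟦ X ⊠ Z , Y ⊠ Z ⟧ ∣
  stT {X} {Y} B Z t = record
    { comp  = λ V → dimap B α α⁻¹ (comp t (Z ⊠ V))
    ; wedge = λ {P} {Q} h → let open SetoidReasoning (B ⟦ _ , _ ⟧) in begin
        dimap B (id ⊠₁ id) (id ⊠₁ h) (dimap B α α⁻¹ (comp t (Z ⊠ P)))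
          ≈⟨ dimap-square B αL αR _ ⟩
        dimap B α α⁻¹ (dimap B (id ⊠₁ id) (id ⊠₁ (id ⊠₁ h)) (comp t (Z ⊠ P)))
          ≈⟨ dimap-cong B (wedge t (id ⊠₁ h)) ⟩
        dimap B α α⁻¹ (dimap B (id ⊠₁ (id ⊠₁ h)) (id ⊠₁ id) (comp t (Z ⊠ Q)))
          ≈⟨ dimap-square B αL′ αR′ _ ⟩
        dimap B (id ⊠₁ h) (id ⊠₁ id) (dimap B α α⁻¹ (comp t (Z ⊠ Q))) ∎
    }
    where
    αL : ∀ {X Z P} → α {X} {Z} {P} ∘ (id ⊠₁ id) ≈ (id ⊠₁ id) ∘ α
    αL = ∘-resp-≈ Equiv.refl ⊠₁-id ▸ identityʳ ▸ Equiv.sym (∘-resp-≈ ⊠₁-id Equiv.refl ▸ identityˡ)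
    αR : ∀ {X Z P Q} {h : P ⇒ Q} → (id ⊠₁ h) ∘ α⁻¹ {X} {Z} ≈ α⁻¹ ∘ (id ⊠₁ (id ⊠₁ h))
    αR = ∘-resp-≈ (⊠₁-cong (Equiv.sym ⊠₁-id) Equiv.refl) Equiv.refl ▸ Equiv.sym α⁻¹-natural
    αL′ : ∀ {X Z P Q} {h : P ⇒ Q} → (id ⊠₁ (id ⊠₁ h)) ∘ α {X} {Z} ≈ α ∘ (id ⊠₁ h)
    αL′ = Equiv.sym α-natural ▸ ∘-resp-≈ Equiv.refl (⊠₁-cong ⊠₁-id Equiv.refl)
    αR′ : ∀ {X Z P} → α⁻¹ {X} {Z} {P} ∘ (id ⊠₁ id) ≈ (id ⊠₁ id) ∘ α⁻¹
    αR′ = ∘-resp-≈ Equiv.refl ⊠₁-id ▸ identityʳ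
          ▸ Equiv.sym (∘-resp-≈ ⊠₁-id Equiv.refl ▸ identityˡ)

  T : Profunctor → StrongProfunctor
  T B = T₀ B ,ₛ record
    { st        = stT B
    ; st-cong   = λ {_} {_} {Z} p V → dimap-cong B (p (Z ⊠ V))
    ; natural   = λ f g t V → dimap-square B
        (Equiv.sym (α-natural ▸ ∘-resp-≈ (⊠₁-cong Equiv.refl ⊠₁-id) Equiv.refl))
        (∘-resp-≈ Equiv.refl (⊠₁-cong Equiv.refl (Equiv.sym ⊠₁-id)) ▸ α⁻¹-natural)
        _
    ; dinatural = λ {_} {_} {Z} {W} h t V → let open SetoidReasoning (B ⟦ _ , _ ⟧) in begin
        dimap B (id ⊠₁ id) ((id ⊠₁ h) ⊠₁ id) (dimap B α α⁻¹ (comp t (Z ⊠ V)))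
          ≈⟨ dimap-square B
               (∘-resp-≈ Equiv.refl ⊠₁-id ▸ identityʳ
                 ▸ Equiv.sym (∘-resp-≈ ⊠₁-id Equiv.refl ▸ identityˡ))
               (Equiv.sym α⁻¹-natural) _ ⟩
        dimap B α α⁻¹ (dimap B (id ⊠₁ id) (id ⊠₁ (h ⊠₁ id)) (comp t (Z ⊠ V)))
          ≈⟨ dimap-cong B (wedge t (h ⊠₁ id)) ⟩
        dimap B α α⁻¹ (dimap B (id ⊠₁ (h ⊠₁ id)) (id ⊠₁ id) (comp t (W ⊠ V)))
          ≈⟨ dimap-square B (Equiv.sym α-natural)
               (∘-resp-≈ Equiv.refl ⊠₁-id ▸ identityʳ
                 ▸ Equiv.sym (∘-resp-≈ ⊠₁-id Equiv.refl ▸ identityˡ)) _ ⟩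
        dimap B ((id ⊠₁ h) ⊠₁ id) (id ⊠₁ id) (dimap B α α⁻¹ (comp t (W ⊠ V))) ∎
    ; st-unit   = λ t V → let open SetoidReasoning (B ⟦ _ , _ ⟧) in begin
        dimap B (id ⊠₁ id) (π₁ ⊠₁ id) (dimap B α α⁻¹ (comp t (𝟙 ⊠ V)))
          ≈⟨ dimap-square B
               (∘-resp-≈ Equiv.refl ⊠₁-id ▸ identityʳ
                 ▸ Equiv.sym (∘-resp-≈ ⊠₁-id Equiv.refl ▸ identityˡ))
               (π₁id∘α⁻¹ ▸ Equiv.sym identityˡ) _ ⟩
        dimap B α id (dimap B (id ⊠₁ id) (id ⊠₁ π₂) (comp t (𝟙 ⊠ V)))
          ≈⟨ dimap-cong B (wedge t π₂) ⟩
        dimap B α id (dimap B (id ⊠₁ π₂) (id ⊠₁ id) (comp t V))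
          ≈⟨ dimap-∘ B _ _ _ _ _ ⟩
        dimap B ((id ⊠₁ π₂) ∘ α) (id ∘ (id ⊠₁ id)) (comp t V)
          ≈⟨ dimap-resp B
               (∘-resp-≈ (Equiv.sym π₁id∘α⁻¹) Equiv.refl
                 ▸ assoc ▸ ∘-resp-≈ Equiv.refl α⁻¹∘α ▸ identityʳ)
               identityˡ _ ⟩
        dimap B (π₁ ⊠₁ id) (id ⊠₁ id) (comp t V) ∎
    ; st-assoc  = λ {X} {Y} {V} {W} t S → let open SetoidReasoning (B ⟦ _ , _ ⟧) in begin
        dimap B α α⁻¹ (dimap B α α⁻¹ (comp t (V ⊠ (W ⊠ S))))
          ≈⟨ dimap-∘ B _ _ _ _ _ ⟩
        dimap B (α ∘ α) (α⁻¹ ∘ α⁻¹) (comp t (V ⊠ (W ⊠ S)))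
          ≈⟨ dimap-resp B (Equiv.sym pentagon) (Equiv.sym pentagon⁻¹) _ ⟩
        dimap B ((id ⊠₁ α) ∘ (α ∘ (α ⊠₁ id))) ((α⁻¹ ⊠₁ id) ∘ (α⁻¹ ∘ (id ⊠₁ α⁻¹)))
                (comp t (V ⊠ (W ⊠ S)))
          ≈⟨ dimap-resp B Equiv.refl (Equiv.sym assoc) _ ⟩
        dimap B ((id ⊠₁ α) ∘ (α ∘ (α ⊠₁ id))) (((α⁻¹ ⊠₁ id) ∘ α⁻¹) ∘ (id ⊠₁ α⁻¹))
                (comp t (V ⊠ (W ⊠ S)))
          ≈⟨ dimap-∘ B _ _ _ _ _ ⟨
        dimap B (α ∘ (α ⊠₁ id)) ((α⁻¹ ⊠₁ id) ∘ α⁻¹)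
                (dimap B (id ⊠₁ α) (id ⊠₁ α⁻¹) (comp t (V ⊠ (W ⊠ S))))
          ≈⟨ dimap-cong B (reassoc t) ⟨
        dimap B (α ∘ (α ⊠₁ id)) ((α⁻¹ ⊠₁ id) ∘ α⁻¹) (comp t ((V ⊠ W) ⊠ S))
          ≈⟨ dimap-∘ B _ _ _ _ _ ⟨
        dimap B (α ⊠₁ id) (α⁻¹ ⊠₁ id) (dimap B α α⁻¹ (comp t ((V ⊠ W) ⊠ S))) ∎
    }
    where
    π₁id∘α⁻¹ : ∀ {X V} → (π₁ ⊠₁ id) ∘ α⁻¹ {X} {𝟙} {V} ≈ id ⊠₁ π₂
    π₁id∘α⁻¹ = ⊠₁∘⟨⟩ ▸ ⟨⟩-cong (project₁ ▸ Equiv.sym identityˡ) identityˡ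

    reassoc : ∀ {X Y V W S} (t : ∣ T₀ B ⟦ X , Y ⟧ ∣) →
              Setoid._≈_ (B ⟦ X ⊠ ((V ⊠ W) ⊠ S) , Y ⊠ ((V ⊠ W) ⊠ S) ⟧)
                (comp t ((V ⊠ W) ⊠ S))
                (dimap B (id ⊠₁ α) (id ⊠₁ α⁻¹) (comp t (V ⊠ (W ⊠ S))))
    reassoc {X} {Y} {V} {W} {S} t = begin
      comp t ((V ⊠ W) ⊠ S)
        ≈⟨ dimap-id B _ ⟨
      dimap B id id (comp t ((V ⊠ W) ⊠ S))
        ≈⟨ dimap-resp B (Equiv.sym identityˡ)
             (Equiv.sym (id⊠₁-∘ ▸ ⊠₁-cong Equiv.refl α⁻¹∘α ▸ ⊠₁-id)) _ ⟩
      dimap B (id ∘ id) ((id ⊠₁ α⁻¹) ∘ (id ⊠₁ α)) (comp t ((V ⊠ W) ⊠ S))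
        ≈⟨ dimap-∘ B _ _ _ _ _ ⟨
      dimap B id (id ⊠₁ α⁻¹) (dimap B id (id ⊠₁ α) (comp t ((V ⊠ W) ⊠ S)))
        ≈⟨ dimap-cong B (dimap-resp B (Equiv.sym ⊠₁-id) Equiv.refl _) ⟩
      dimap B id (id ⊠₁ α⁻¹) (dimap B (id ⊠₁ id) (id ⊠₁ α) (comp t ((V ⊠ W) ⊠ S)))
        ≈⟨ dimap-cong B (wedge t α) ⟩
      dimap B id (id ⊠₁ α⁻¹) (dimap B (id ⊠₁ α) (id ⊠₁ id) (comp t (V ⊠ (W ⊠ S))))
        ≈⟨ dimap-∘ B _ _ _ _ _ ⟩
      dimap B ((id ⊠₁ α) ∘ id) ((id ⊠₁ α⁻¹) ∘ (id ⊠₁ id)) (comp t (V ⊠ (W ⊠ S)))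
        ≈⟨ dimap-resp B identityʳ (∘-resp-≈ Equiv.refl ⊠₁-id ▸ identityʳ) _ ⟩
      dimap B (id ⊠₁ α) (id ⊠₁ α⁻¹) (comp t (V ⊠ (W ⊠ S))) ∎
      where open SetoidReasoning (B ⟦ _ , _ ⟧)

{-# OPTIONS --safe #-}
module Submission where

-- Write a · b for m[a,b].  Since m is natural and well defined on the coend,
-- A(f,id)(a · A(g,id)(b)) = A(f,g)(a) · b; this one identity turns the naturality,
-- dinaturality and associativity of st into the naturality, wedge condition and
-- strength of rep.  The right unit law gives st₁(a) · e(π₁) = A(id,π₁)(st₁ a), which is
-- A(π₁,id)(a) by the unit law of st, so abs is a retraction of rep.

open import Defs
open import Data.Product.Base using (Σ-syntax; _×_; _,_)
open import Function.Bundles using (Func; _⟨$⟩_)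
open import Relation.Binary.Bundles using (Setoid)
import Relation.Binary.Reasoning.Setoid as SetoidReasoning

module _ {o ℓ} (C : Category o ℓ) where
  open Category C

  retraction⇒mono : ∀ {X Y} {f : X ⇒ Y} (r : Y ⇒ X) → r ∘ f ≈ id → Mono C f
  retraction⇒mono {f = f} r r∘f≈id g h f∘g≈f∘h = begin
    g           ≈⟨ identityˡ ⟨
    id ∘ g      ≈⟨ ∘-resp-≈ r∘f≈id Equiv.refl ⟨
    (r ∘ f) ∘ g ≈⟨ assoc ⟩
    r ∘ f ∘ g   ≈⟨ ∘-resp-≈ Equiv.refl f∘g≈f∘h ⟩
    r ∘ f ∘ h   ≈⟨ assoc ⟨
    (r ∘ f) ∘ h ≈⟨ ∘-resp-≈ r∘f≈id Equiv.refl ⟩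
    id ∘ h      ≈⟨ identityˡ ⟩
    h           ∎
    where open SetoidReasoning (hom-setoid _ _)

module Representation {ℓ} (C : Category ℓ ℓ) (ccc : CartesianClosed C)
                      (M : StrongProfunctors.Monoid C ccc) where
  open Category C
  open CartesianClosed ccc
  open StrongProfunctors C ccc
  open Monoid M renaming (carrier to 𝐀)
  open StrongProfunctor 𝐀 renaming (profunctor to A)
  open StrongNatTrans using (natTrans)

  private
    variable
      P Q X X′ Y Y′ : Obj

    module A {X Y} = Setoid (A ⟦ X , Y ⟧)
    module AR {X Y} = SetoidReasoning (A ⟦ X , Y ⟧)

  TAᴬ : StrongProfunctor
  TAᴬ = T (A ^ A)

  μ : Pro [ A ⊗ A , A ]
  μ = natTrans m

  ι : Pro [ HomP , A ]
  ι = natTrans e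

  infixl 7 _·_
  _·_ : ∣ A ⟦ X , P ⟧ ∣ → ∣ A ⟦ P , Y ⟧ ∣ → ∣ A ⟦ X , Y ⟧ ∣
  _·_ {P = P} a b = app μ (class A A P a b)

  ·-cong : {a a′ : ∣ A ⟦ X , P ⟧ ∣} {b b′ : ∣ A ⟦ P , Y ⟧ ∣} →
           a A.≈ a′ → b A.≈ b′ → a · b A.≈ a′ · b′
  ·-cong p q = app-cong μ (coend-equal (tensorIntegrand A A _ _) (p , q))

  -- The coend relation in one-sided form: `coend-glue` also carries an identity action on the other
  -- factor, which `dimap-id` removes.
  ·-slide : (f : P ⇒ Q) (a : ∣ A ⟦ X , P ⟧ ∣) (b : ∣ A ⟦ Q , Y ⟧ ∣) →
            a · dimap A f id b A.≈ dimap A id f a · b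
  ·-slide f a b = begin
    a · dimap A f id b               ≈⟨ ·-cong (dimap-id A a) A.refl ⟨
    dimap A id id a · dimap A f id b ≈⟨ app-cong μ
                                          (coend-glue (tensorIntegrand A A _ _) f (a , b)) ⟩
    dimap A id f a · dimap A id id b ≈⟨ ·-cong A.refl (dimap-id A b) ⟩
    dimap A id f a · b               ∎
    where open AR

  ·-natural : (f : X′ ⇒ X) (g : Y ⇒ Y′) (a : ∣ A ⟦ X , P ⟧ ∣) (b : ∣ A ⟦ P , Y ⟧ ∣) →
              dimap A f g (a · b) A.≈ dimap A f id a · dimap A id g b
  ·-natural {P = P} f g a b = A.sym (app-natural μ f g (class A A P a b))

  -- The right unit law evaluated at the class `[a,f]`, which `unitʳ` sends to `A(id,f)(a)`.
  ·-unitʳ : (a : ∣ A ⟦ X , P ⟧ ∣) (f : P ⇒ Y) → a · app ι f A.≈ dimap A id f a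
  ·-unitʳ {P = P} a f = m-unitʳ _ (P , a , f)

  -- The inner `g` slides across the coend onto `a` and merges there with `f`. The left side is
  -- exactly how `A ^ A` acts on multiplication by `a`.
  ·-dimap : (f : X′ ⇒ X) (g : P ⇒ Q) (a : ∣ A ⟦ X , P ⟧ ∣) (b : ∣ A ⟦ Q , Y ⟧ ∣) →
            dimap A f id (a · dimap A g id b) A.≈ dimap A f g a · b
  ·-dimap f g a b = begin
    dimap A f id (a · dimap A g id b)            ≈⟨ dimap-cong A (·-slide g a b) ⟩
    dimap A f id (dimap A id g a · b)            ≈⟨ ·-natural f id _ b ⟩
    dimap A f id (dimap A id g a) · dimap A id id b
      ≈⟨ ·-cong (A.trans (dimap-∘ A _ _ _ _ a) (dimap-resp A identityˡ identityˡ a))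
                (dimap-id A b) ⟩
    dimap A f g a · b                            ∎
    where open AR

  -- The transpose `A → A ^ A` of `μ` under right closedness. Its wedge condition is the naturality
  -- of `μ` in the right-hand variable.
  leftMul : ∣ A ⟦ X , Y ⟧ ∣ → ∣ (A ^ A) ⟦ X , Y ⟧ ∣
  leftMul a = record
    { comp  = λ D → record { to = a ·_ ; cong = ·-cong A.refl }
    ; wedge = λ h b → let open AR in begin
        dimap A id h (a · dimap A id id b)  ≈⟨ dimap-cong A (·-cong A.refl (dimap-id A b)) ⟩
        dimap A id h (a · b)                ≈⟨ ·-natural id h a b ⟩
        dimap A id id a · dimap A id h b    ≈⟨ ·-cong (dimap-id A a) A.refl ⟩
        a · dimap A id h b                  ≈⟨ dimap-id A _ ⟨
        dimap A id id (a · dimap A id h b)  ∎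
    }

  leftMul-cong : {a a′ : ∣ A ⟦ X , Y ⟧ ∣} → a A.≈ a′ →
                 Setoid._≈_ ((A ^ A) ⟦ X , Y ⟧) (leftMul a) (leftMul a′)
  leftMul-cong p D b = ·-cong p A.refl

  -- Naturality of the transpose. Together with `leftMul-cong` it carries equations between values
  -- of `st` in `A` over to `A ^ A`, so each law of `rep` reduces to a law of `st`.
  leftMul-dimap : (f : X′ ⇒ X) (g : Y ⇒ Y′) (a : ∣ A ⟦ X , Y ⟧ ∣) →
                  Setoid._≈_ ((A ^ A) ⟦ X′ , Y′ ⟧)
                    (dimap (A ^ A) f g (leftMul a)) (leftMul (dimap A f g a))
  leftMul-dimap f g a D b = ·-dimap f g a b

  rep₀ : ∣ A ⟦ X , Y ⟧ ∣ → ∣ T₀ (A ^ A) ⟦ X , Y ⟧ ∣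
  rep₀ {X} {Y} a = record
    { comp  = λ Z → leftMul (st Z a)
    ; wedge = λ {P} {Q} h → let open SetoidReasoning ((A ^ A) ⟦ X ⊠ P , Y ⊠ Q ⟧) in begin
        dimap (A ^ A) (id ⊠₁ id) (id ⊠₁ h) (leftMul (st P a))
          ≈⟨ leftMul-dimap _ _ _ ⟩
        leftMul (dimap A (id ⊠₁ id) (id ⊠₁ h) (st P a))
          ≈⟨ leftMul-cong (wedge-st h) ⟩
        leftMul (dimap A (id ⊠₁ h) (id ⊠₁ id) (st Q a))
          ≈⟨ leftMul-dimap _ _ _ ⟨
        dimap (A ^ A) (id ⊠₁ h) (id ⊠₁ id) (leftMul (st Q a)) ∎
    }
    where
    -- The integrand of `T` acts by `id ⊠₁ id` where `dinatural` has `id`; otherwise this is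
    -- dinaturality.
    wedge-st : (h : P ⇒ Q) → dimap A (id ⊠₁ id) (id ⊠₁ h) (st P a)
                             A.≈ dimap A (id ⊠₁ h) (id ⊠₁ id) (st Q a)
    wedge-st {P} {Q} h = begin
      dimap A (id ⊠₁ id) (id ⊠₁ h) (st P a) ≈⟨ dimap-resp A ⊠₁-id Equiv.refl _ ⟩
      dimap A id (id ⊠₁ h) (st P a)         ≈⟨ dinatural h a ⟩
      dimap A (id ⊠₁ h) id (st Q a)         ≈⟨ dimap-resp A Equiv.refl ⊠₁-id _ ⟨
      dimap A (id ⊠₁ h) (id ⊠₁ id) (st Q a) ∎
      where open AR

  rep : SPro [ 𝐀 , TAᴬ ]
  rep = record
    { natTrans = record
      { η       = λ _ → record
        { to   = rep₀
        ; cong = λ p Z → leftMul-cong (st-cong p) }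
      ; commute = λ { {X , Y} {X′ , Y′} (f , g) a Z →
          let open SetoidReasoning ((A ^ A) ⟦ X′ ⊠ Z , Y′ ⊠ Z ⟧) in begin
          leftMul (st Z (dimap A f g a))                       ≈⟨ leftMul-cong (natural f g a) ⟩
          leftMul (dimap A (f ⊠₁ id) (g ⊠₁ id) (st Z a))       ≈⟨ leftMul-dimap _ _ _ ⟨
          dimap (A ^ A) (f ⊠₁ id) (g ⊠₁ id) (leftMul (st Z a)) ∎ }
      }
    -- The strength of `T` is defined by `α` and `α⁻¹` on the component at `Z ⊠ V`, so compatibility
    -- with it is `st-assoc`.
    ; strong   = λ {X} {Y} Z a V →
        let open SetoidReasoning ((A ^ A) ⟦ (X ⊠ Z) ⊠ V , (Y ⊠ Z) ⊠ V ⟧) in begin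
        leftMul (st V (st Z a))                        ≈⟨ leftMul-cong (st-assoc a) ⟩
        leftMul (dimap A α α⁻¹ (st (Z ⊠ V) a))         ≈⟨ leftMul-dimap _ _ _ ⟨
        dimap (A ^ A) α α⁻¹ (leftMul (st (Z ⊠ V) a))   ∎
    }

  -- By naturality of `ι` both sides equal `app ι (g ∘ π₁)`. This trades the action of `g` on
  -- `Y ⊠ 𝟙` for one on the covariant variable, to which the wedge condition over `D` applies.
  unit-π₁ : (g : Y ⇒ Y′) → dimap A (g ⊠₁ id {𝟙}) id (app ι π₁)
                           A.≈ dimap A id g (app ι π₁)
  unit-π₁ g = begin
    dimap A (g ⊠₁ id) id (app ι π₁) ≈⟨ app-natural ι (g ⊠₁ id) id π₁ ⟨
    app ι (id ∘ π₁ ∘ (g ⊠₁ id))     ≈⟨ app-cong ι (Equiv.trans identityˡ project₁) ⟩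
    app ι (g ∘ π₁)                  ≈⟨ app-cong ι (∘-resp-≈ Equiv.refl identityʳ) ⟨
    app ι (g ∘ π₁ ∘ id)             ≈⟨ app-natural ι id g π₁ ⟩
    dimap A id g (app ι π₁)         ∎
    where open AR

  π₁⁻¹-natural : (f : X ⇒ Y) → (f ⊠₁ id) ∘ π₁⁻¹ ≈ π₁⁻¹ ∘ f
  π₁⁻¹-natural f = begin
    (f ⊠₁ id) ∘ ⟨ id , ! ⟩ ≈⟨ ⊠₁∘⟨⟩ ⟩
    -- The second components agree because both are maps into `𝟙`.
    ⟨ f ∘ id , id ∘ ! ⟩    ≈⟨ ⟨⟩-cong (Equiv.trans identityʳ (Equiv.sym identityˡ))
                                (Equiv.trans (Equiv.sym (!-unique _)) (!-unique _)) ⟩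
    ⟨ id ∘ f , ! ∘ f ⟩     ≈⟨ ⟨⟩∘ ⟨
    ⟨ id , ! ⟩ ∘ f         ∎
    where open SetoidReasoning (hom-setoid _ _)

  abs₀ : ∣ T₀ (A ^ A) ⟦ X , Y ⟧ ∣ → ∣ A ⟦ X , Y ⟧ ∣
  abs₀ {Y = Y} h = dimap A π₁⁻¹ id (comp (comp h 𝟙) Y ⟨$⟩ app ι π₁)

  -- Here `f` moves out past `π₁⁻¹` by naturality of the latter, while `g` crosses `h` by way of
  -- `unit-π₁` and the inner wedge condition.
  abs-natural : (f : X′ ⇒ X) (g : Y ⇒ Y′) (h : ∣ T₀ (A ^ A) ⟦ X , Y ⟧ ∣) →
                abs₀ (dimap (T₀ (A ^ A)) f g h) A.≈ dimap A f g (abs₀ h)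
  abs-natural {Y = Y} {Y′ = Y′} f g h = begin
    dimap A π₁⁻¹ id (dimap A (f ⊠₁ id) id (h₁ Y′ ⟨$⟩ dimap A (g ⊠₁ id) id u))
      ≈⟨ dimap-square A (π₁⁻¹-natural f) Equiv.refl _ ⟩
    dimap A f id (dimap A π₁⁻¹ id (h₁ Y′ ⟨$⟩ dimap A (g ⊠₁ id) id u))
      ≈⟨ dimap-cong A (dimap-cong A (Func.cong (h₁ Y′) (unit-π₁ g))) ⟩
    dimap A f id (dimap A π₁⁻¹ id (h₁ Y′ ⟨$⟩ dimap A id g u))
      ≈⟨ dimap-cong A (dimap-cong A (dimap-id A _)) ⟨
    dimap A f id (dimap A π₁⁻¹ id (dimap A id id (h₁ Y′ ⟨$⟩ dimap A id g u)))
      -- The wedge condition over `D` moves `g` from the argument to the result, replacing the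
      -- component at `Y′` by the one at `Y`.
      ≈⟨ dimap-cong A (dimap-cong A (wedge (comp h 𝟙) g u)) ⟨
    dimap A f id (dimap A π₁⁻¹ id (dimap A id g (h₁ Y ⟨$⟩ dimap A id id u)))
      ≈⟨ dimap-cong A (dimap-cong A (dimap-cong A (Func.cong (h₁ Y) (dimap-id A u)))) ⟩
    dimap A f id (dimap A π₁⁻¹ id (dimap A id g (h₁ Y ⟨$⟩ u)))
      ≈⟨ dimap-cong A (dimap-square A (Equiv.trans identityˡ (Equiv.sym identityʳ))
                                      (Equiv.trans identityˡ (Equiv.sym identityʳ)) _) ⟩
    dimap A f id (dimap A id g (abs₀ h))
      ≈⟨ dimap-∘ A _ _ _ _ _ ⟩
    dimap A (id ∘ f) (id ∘ g) (abs₀ h)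
      ≈⟨ dimap-resp A identityˡ identityˡ _ ⟩
    dimap A f g (abs₀ h) ∎
    where
    open AR
    h₁ = comp (comp h 𝟙)
    u : ∀ {Y} → ∣ A ⟦ Y ⊠ 𝟙 , Y ⟧ ∣
    u = app ι π₁

  abs : Pro [ T₀ (A ^ A) , A ]
  abs = record
    { η       = λ { (X , Y) → record
      { to   = abs₀
      ; cong = λ p → dimap-cong A (p 𝟙 Y _) } }
    ; commute = λ (f , g) → abs-natural f g
    }

  abs∘rep : (a : ∣ A ⟦ X , Y ⟧ ∣) → abs₀ (rep₀ a) A.≈ a
  abs∘rep a = begin
    dimap A π₁⁻¹ id (st 𝟙 a · app ι π₁) ≈⟨ dimap-cong A (·-unitʳ _ π₁) ⟩
    dimap A π₁⁻¹ id (dimap A id π₁ (st 𝟙 a))       ≈⟨ dimap-cong A (st-unit a) ⟩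
    dimap A π₁⁻¹ id (dimap A π₁ id a)              ≈⟨ dimap-∘ A _ _ _ _ a ⟩
    dimap A (π₁ ∘ π₁⁻¹) (id ∘ id) a                ≈⟨ dimap-resp A project₁ identityˡ a ⟩
    dimap A id id a                                ≈⟨ dimap-id A a ⟩
    a                                              ∎
    where open AR

  -- The retraction `abs` lives only in `Pro`, but equality in `SPro` is equality of underlying
  -- natural transformations, so cancelling there suffices.
  rep-mono : Mono SPro rep
  rep-mono g h =
    retraction⇒mono Pro {f = natTrans rep} abs (λ _ → abs∘rep) (natTrans g) (natTrans h)

mainTheorem6 :
    ∀ {ℓ} (𝒮 : Subcategory (Setoids ℓ) ℓ) (ccc : CartesianClosed (Subcategory.category 𝒮)) →
    let 𝒞 = Subcategory.category 𝒮
        open CartesianClosed ccc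
        open StrongProfunctors 𝒞 ccc
        open Functor U using (F₀) renaming (F₁ to U₁)
    in
    (M : Monoid) →
    let open Monoid M renaming (carrier to 𝐀)
        open StrongProfunctor 𝐀 using (st)
        A   = F₀ 𝐀
        TAᴬ = T (A ^ A)
    in
    Σ[ rep ∈ SPro [ 𝐀 , TAᴬ ] ] Σ[ abs ∈ Pro [ F₀ TAᴬ , F₀ 𝐀 ] ]
      (∀ X Y (a : ∣ A ⟦ X , Y ⟧ ∣) Z D (b : ∣ A ⟦ Y ⊠ Z , D ⟧ ∣) →
        Setoid._≈_ (A ⟦ X ⊠ Z , D ⟧)
          (comp (comp (app (U₁ rep) a) Z) D ⟨$⟩ b)
          (app (U₁ m) (class A A (Y ⊠ Z) (st Z a) b)))
      × (∀ X Y (h : ∣ F₀ TAᴬ ⟦ X , Y ⟧ ∣) →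
        Setoid._≈_ (A ⟦ X , Y ⟧)
          (app abs h)
          (dimap A π₁⁻¹ (Category.id 𝒞) (comp (comp h 𝟙) Y ⟨$⟩ app (U₁ e) π₁)))
      × Pro [ Category._∘_ Pro abs (U₁ rep) ≈ Category.id Pro ]
      × Mono SPro rep
mainTheorem6 𝒮 ccc M =
    R.rep , R.abs
  -- Both prescribed formulas hold by unfolding `rep` and `abs`.
  , (λ X Y a Z D b → Setoid.refl (A ⟦ _ , _ ⟧))
  , (λ X Y h → Setoid.refl (A ⟦ _ , _ ⟧))
  , (λ _ → R.abs∘rep)
  , R.rep-mono
  where
  module R = Representation (Subcategory.category 𝒮) ccc M
  open StrongProfunctors (Subcategory.category 𝒮) ccc
  A = StrongProfunctor.profunctor (Monoid.carrier M)
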